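{- For every integer $d\ge 0$, $$E_d = \sum_{\delta\in \mathrm{PCom}_{\mathrm{dyad}}(d)} (-1)^{\ell(\delta)}E_\delta^+.$$
   Context: A composition of $n\ge 0$ is a finite tuple of positive integers with sum $n$; its length $\ell$ is the number of entries; the empty composition is the only composition of $0$. A polycomposition of $n$ is a sequence $\delta=(\alpha^{(1)},\alpha^{(2)},\dots)$ of (possibly empty) compositions with $\sum_{i\ge1} i|\alpha^{(i)}|=n$, where $|\alpha|$ is the sum of the entries of $\alpha$; write $\delta|^i=\alpha^{(i)}$ and $\ell(\delta)=\sum_i\ell(\delta|^i)$. Each part $d$ of $\delta|^r$ gives a block $d^r$ of $\delta$ (degree $d$, multiplicity $r$; not exponentiation). $\mathrm{PCom}_{\mathrm{dyad}}(d)$ is the set of dyadic polycompositions of $d$: those in which all multiplicities are powers of $2$, i.e. $\delta|^i$ is empty unless $i=2^k$ for some $k\ge 0$. Let $x_{i,j}$ ($i,j\ge 1$) be indeterminates with $\deg x_{i,j}=i$; all series have rational coefficients. A monomial is square-free if every exponent is at most $1$. For $d\ge 0$, $E^+_d$ is the sum of all square-free monomials of degree $d$, and $E_d$ is the sum over square-free monomials $f$ of degree $d$ of $(-1)^{m(f)}f$, where $m(f)$ is the number of indeterminates in $f$. For a block $d^r$, $E^+_{d^r}$ is obtained from $E^+_d$ by replacing each $x_{i,j}$ by $x_{i,j}^r$, and $E^+_\delta=\prod E^+_{d^r}$ over all blocks $d^r$ of $\delta$ (counted with repetition; empty product $=1$). -}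

module Defs where

open import Data.Nat as ℕ using (ℕ; zero; suc; _≤_; _<_; _∸_; _^_; NonZero; z≤n; s≤s)
import Data.Nat.Properties as ℕ
open import Data.Nat.ListAction using (sum)
open import Data.Nat.Divisibility using (_∣_; _∣?_; _∣0)
open import Data.Nat.DivMod using (_/_; 0/n≡0)
open import Data.Rational using (ℚ; 0ℚ; 1ℚ; _+_; _*_; -_)
open import Data.Fin using (Fin; toℕ; fromℕ<)
import Data.Fin.Properties as Fin
open import Data.List as List
  using (List; []; _∷_; foldr; length; upTo; concatMap; cartesianProductWith; filter)
import Data.List.Properties as List
open import Data.List.Membership.Propositional using (_∈_; find; lose)
open import Data.List.Membership.Propositional.Properties
  using ( ∈-concatMap⁺; ∈-concatMap⁻; ∈-upTo⁺; ∈-filter⁺; ∈-filter⁻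
        ; ∈-cartesianProductWith⁺)
open import Data.List.Relation.Unary.All as ListAll using ([]; _∷_)
open import Data.List.Relation.Unary.Any using (here; there)
open import Data.List.Relation.Unary.AllPairs using ([]; _∷_)
open import Data.List.Relation.Unary.Unique.Propositional using (Unique)
import Data.List.Relation.Unary.Unique.Propositional.Properties as Unique
open import Data.Vec as Vec using (Vec; []; _∷_; _∷ʳ_; replicate; lookup; count)
import Data.Vec.Properties as Vec
open import Data.Vec.Relation.Unary.All as VecAll using ([]; _∷_)
open import Data.Product using (∃; _×_; _,_; proj₂)
open import Data.Bool using (if_then_else_)
open import Function using (_∘_; _⇔_; mk⇔)
open import Relation.Nullary using (Dec; does; ¬?; _×-dec_; _→-dec_)
open import Relation.Nullary.Decidable using (map′; does-⇔)
open import Relation.Unary using (Decidable)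
open import Relation.Binary.PropositionalEquality

private variable
  A B C : Set
  m n N : ℕ

-- weighted k (v₀ , v₁ , …) = k v₀ + (k + 1) v₁ + (k + 2) v₂ + …
weighted : ℕ → Vec ℕ n → ℕ
weighted k []       = 0
weighted k (v ∷ vs) = k ℕ.* v ℕ.+ weighted (suc k) vs

Exponents : ℕ → ℕ → Set
Exponents m n = Vec (Vec ℕ n) m

-- A monomial in the finitely many indeterminates x_{i,j} with
-- 1 ≤ i , j ≤ N: row i - 1, column j - 1 holds the exponent of x_{i,j}.
Monomial : ℕ → Set
Monomial N = Exponents N N

-- The same monomial, with the indeterminates for the next value of N
-- added with exponent 0.
pad : Exponents m n → Exponents (suc m) (suc n)
pad e = Vec.map (_∷ʳ 0) e ∷ʳ replicate _ 0

degree : Exponents m n → ℕ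
degree e = weighted 1 (Vec.map Vec.sum e)

AllExponents : (ℕ → Set) → Exponents m n → Set
AllExponents P = VecAll.All (VecAll.All P)

allExponents? : {P : ℕ → Set} → Decidable P → Decidable (AllExponents {m} {n} P)
allExponents? P? = VecAll.all? (VecAll.all? P?)

SquareFree : Exponents m n → Set
SquareFree = AllExponents (_≤ 1)

squareFreeOfDegree? : ∀ d (e : Exponents m n) → Dec (SquareFree e × degree e ≡ d)
squareFreeOfDegree? d e = allExponents? (ℕ._≤? 1) e ×-dec degree e ℕ.≟ d

numIndeterminates : Exponents m n → ℕ
numIndeterminates e = Vec.sum (Vec.map (count (1 ℕ.≤?_)) e)

-- All ways of writing each entry as a sum of two; for a monomial e these
-- are the pairs (a , b) of monomials with a b = e, each listed once.

splitsℕ : ℕ → List (ℕ × ℕ)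
splitsℕ n = List.map (λ a → a , n ∸ a) (upTo (suc n))

∷-both : A × A → Vec A n × Vec A n → Vec A (suc n) × Vec A (suc n)
∷-both (a , b) (as , bs) = a ∷ as , b ∷ bs

splitsVec : (A → List (A × A)) → Vec A n → List (Vec A n × Vec A n)
splitsVec s []       = ([] , []) ∷ []
splitsVec s (x ∷ xs) = cartesianProductWith ∷-both (s x) (splitsVec s xs)

splits : Exponents m n → List (Exponents m n × Exponents m n)
splits = splitsVec (splitsVec splitsℕ)

weighted-∷ʳ0 : ∀ k (vs : Vec ℕ n) → weighted k (vs ∷ʳ 0) ≡ weighted k vs
weighted-∷ʳ0 k []       = trans (ℕ.+-identityʳ _) (ℕ.*-zeroʳ k)
weighted-∷ʳ0 k (v ∷ vs) = cong (k ℕ.* v ℕ.+_) (weighted-∷ʳ0 (suc k) vs)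

sum-∷ʳ0 : (vs : Vec ℕ n) → Vec.sum (vs ∷ʳ 0) ≡ Vec.sum vs
sum-∷ʳ0 []       = refl
sum-∷ʳ0 (v ∷ vs) = cong (v ℕ.+_) (sum-∷ʳ0 vs)

sum-zeros : ∀ n → Vec.sum (replicate n 0) ≡ 0
sum-zeros zero    = refl
sum-zeros (suc n) = sum-zeros n

count-zeros : ∀ n → count (1 ℕ.≤?_) (replicate n 0) ≡ 0
count-zeros zero    = refl
count-zeros (suc n) = count-zeros n

count-∷ʳ0 : (vs : Vec ℕ n) → count (1 ℕ.≤?_) (vs ∷ʳ 0) ≡ count (1 ℕ.≤?_) vs
count-∷ʳ0 []           = refl
count-∷ʳ0 (zero  ∷ vs) = count-∷ʳ0 vs
count-∷ʳ0 (suc _ ∷ vs) = cong suc (count-∷ʳ0 vs)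

-- f is a row statistic that ignores trailing zeros
map-pad : (f : ∀ {n} → Vec ℕ n → ℕ) →
          (∀ {n} (v : Vec ℕ n) → f (v ∷ʳ 0) ≡ f v) → (∀ n → f (replicate n 0) ≡ 0) →
          (e : Exponents m n) → Vec.map f (pad e) ≡ Vec.map f e ∷ʳ 0
map-pad f f-∷ʳ f-0 []      = cong (_∷ []) (f-0 _)
map-pad f f-∷ʳ f-0 (v ∷ e) = cong₂ _∷_ (f-∷ʳ v) (map-pad f f-∷ʳ f-0 e)

degree-pad : (e : Exponents m n) → degree (pad e) ≡ degree e
degree-pad e = trans (cong (weighted 1) (map-pad Vec.sum sum-∷ʳ0 sum-zeros e))
                     (weighted-∷ʳ0 1 (Vec.map Vec.sum e))

numIndeterminates-pad : (e : Exponents m n) → numIndeterminates (pad e) ≡ numIndeterminates e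
numIndeterminates-pad e =
  trans (cong Vec.sum (map-pad (count (1 ℕ.≤?_)) count-∷ʳ0 count-zeros e))
        (sum-∷ʳ0 (Vec.map (count (1 ℕ.≤?_)) e))

module _ {P : ℕ → Set} (P0 : P 0) where
  zeros⁺ : ∀ n → VecAll.All P (replicate n 0)
  zeros⁺ zero    = []
  zeros⁺ (suc n) = P0 ∷ zeros⁺ n

  ∷ʳ0⁺ : {v : Vec ℕ n} → VecAll.All P v → VecAll.All P (v ∷ʳ 0)
  ∷ʳ0⁺ []       = P0 ∷ []
  ∷ʳ0⁺ (p ∷ ps) = p ∷ ∷ʳ0⁺ ps

  ∷ʳ0⁻ : (v : Vec ℕ n) → VecAll.All P (v ∷ʳ 0) → VecAll.All P v
  ∷ʳ0⁻ []      _        = []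
  ∷ʳ0⁻ (_ ∷ v) (p ∷ ps) = p ∷ ∷ʳ0⁻ v ps

  pad⁺ : {e : Exponents m n} → AllExponents P e → AllExponents P (pad e)
  pad⁺ []       = zeros⁺ _ ∷ []
  pad⁺ (p ∷ ps) = ∷ʳ0⁺ p ∷ pad⁺ ps

  pad⁻ : (e : Exponents m n) → AllExponents P (pad e) → AllExponents P e
  pad⁻ []      _        = []
  pad⁻ (v ∷ e) (p ∷ ps) = ∷ʳ0⁻ v p ∷ pad⁻ e ps

  AllExponents-pad : (e : Exponents m n) → AllExponents P (pad e) ⇔ AllExponents P e
  AllExponents-pad e = mk⇔ (pad⁻ e) pad⁺

squareFreeOfDegree-pad : ∀ d (e : Exponents m n) →
  does (squareFreeOfDegree? d (pad e)) ≡ does (squareFreeOfDegree? d e)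
squareFreeOfDegree-pad d e = does-⇔
  (mk⇔ (λ (s , q) → pad⁻ z≤n e s , trans (sym (degree-pad e)) q)
       (λ (s , q) → pad⁺ z≤n s , trans (degree-pad e) q))
  (squareFreeOfDegree? d (pad e)) (squareFreeOfDegree? d e)

both : (A → B) → A × A → B × B
both h (a , b) = h a , h b

cartesianProductWith-map : ∀ {A′ B′ C′ : Set} {f : A → B → C} {f′ : A′ → B′ → C′}
  {g : A → A′} {h : B → B′} {l : C → C′} → (∀ x y → f′ (g x) (h y) ≡ l (f x y)) →
  ∀ xs ys → cartesianProductWith f′ (List.map g xs) (List.map h ys)
          ≡ List.map l (cartesianProductWith f xs ys)
cartesianProductWith-map eq []       ys = refl
cartesianProductWith-map {f = f} {f′} {g} {h} {l} eq (x ∷ xs) ys = begin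
  List.map (f′ (g x)) (List.map h ys) List.++ cartesianProductWith f′ (List.map g xs) (List.map h ys)
    ≡⟨ cong₂ List._++_
         (trans (sym (List.map-∘ ys)) (trans (List.map-cong (eq x) ys) (List.map-∘ ys)))
         (cartesianProductWith-map eq xs ys) ⟩
  List.map l (List.map (f x) ys) List.++ List.map l (cartesianProductWith f xs ys)
    ≡⟨ List.map-++ l (List.map (f x) ys) _ ⟨
  List.map l (List.map (f x) ys List.++ cartesianProductWith f xs ys) ∎
  where open ≡-Reasoning

splitsVec-zeros : (s : A → List (A × A)) {z : A} → s z ≡ (z , z) ∷ [] → ∀ n →
  splitsVec s (replicate n z) ≡ (replicate n z , replicate n z) ∷ []
splitsVec-zeros s sz zero    = refl
splitsVec-zeros s sz (suc n) rewrite sz | splitsVec-zeros s sz n = refl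

splitsVec-∷ʳ : (s : A → List (A × A)) (t : B → List (B × B)) (h : A → B) {z : B} →
  (∀ x → t (h x) ≡ List.map (both h) (s x)) → t z ≡ (z , z) ∷ [] → (xs : Vec A n) →
  splitsVec t (Vec.map h xs ∷ʳ z) ≡ List.map (both (λ ys → Vec.map h ys ∷ʳ z)) (splitsVec s xs)
splitsVec-∷ʳ s t h th tz []       rewrite tz = refl
splitsVec-∷ʳ s t h th tz (x ∷ xs) rewrite th x | splitsVec-∷ʳ s t h th tz xs =
  cartesianProductWith-map (λ _ _ → refl) (s x) (splitsVec s xs)

splitsVec-∷ʳ0 : (v : Vec ℕ n) →
  splitsVec splitsℕ (v ∷ʳ 0) ≡ List.map (both (_∷ʳ 0)) (splitsVec splitsℕ v)
splitsVec-∷ʳ0 []      = refl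
splitsVec-∷ʳ0 (x ∷ v) rewrite splitsVec-∷ʳ0 v = trans
  (cong (λ ss → cartesianProductWith ∷-both ss (List.map (both (_∷ʳ 0)) (splitsVec splitsℕ v)))
        (sym (List.map-id (splitsℕ x))))
  (cartesianProductWith-map (λ _ _ → refl) (splitsℕ x) (splitsVec splitsℕ v))

splits-pad : (e : Exponents m n) → splits (pad e) ≡ List.map (both pad) (splits e)
splits-pad {n = n} = splitsVec-∷ʳ (splitsVec splitsℕ) (splitsVec splitsℕ) (_∷ʳ 0)
  splitsVec-∷ʳ0 (splitsVec-zeros splitsℕ refl (suc n))

-- Every monomial lies in Monomial N for all large N, and its
-- representatives there are paddings of one another; hence `stable`.
record Series : Set where
  field
    coeff  : Monomial N → ℚ
    stable : (e : Monomial N) → coeff (pad e) ≡ coeff e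

open Series public

infix  4 _≈_
infixr 7 _·_
infixl 7 _⊛_
infixl 6 _⊕_
infixl 8 _[x^_]

_≈_ : Series → Series → Set
f ≈ g = ∀ {N} (e : Monomial N) → coeff f e ≡ coeff g e

sumℚ : List ℚ → ℚ
sumℚ = foldr _+_ 0ℚ

-- (-1)ᵏ
sign : ℕ → ℚ
sign zero    = 1ℚ
sign (suc k) = - sign k

𝟘 : Series
𝟘 .coeff  _ = 0ℚ
𝟘 .stable _ = refl

𝟙 : Series
𝟙 .coeff  e = if does (allExponents? (ℕ._≟ 0) e) then 1ℚ else 0ℚ
𝟙 .stable e = cong (if_then 1ℚ else 0ℚ)
  (does-⇔ (AllExponents-pad refl e) (allExponents? (ℕ._≟ 0) (pad e)) (allExponents? (ℕ._≟ 0) e))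

_⊕_ : Series → Series → Series
(f ⊕ g) .coeff  e = coeff f e + coeff g e
(f ⊕ g) .stable e = cong₂ _+_ (stable f e) (stable g e)

_·_ : ℚ → Series → Series
(c · f) .coeff  e = c * coeff f e
(c · f) .stable e = cong (c *_) (stable f e)

_⊛_ : Series → Series → Series
(f ⊛ g) .coeff  e = sumℚ (List.map (λ (a , b) → coeff f a * coeff g b) (splits e))
(f ⊛ g) .stable e = cong sumℚ (begin
  List.map (λ (a , b) → coeff f a * coeff g b) (splits (pad e))
    ≡⟨ cong (List.map _) (splits-pad e) ⟩
  List.map (λ (a , b) → coeff f a * coeff g b) (List.map (both pad) (splits e))
    ≡⟨ List.map-∘ (splits e) ⟨
  List.map (λ (a , b) → coeff f (pad a) * coeff g (pad b)) (splits e)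
    ≡⟨ List.map-cong (λ (a , b) → cong₂ _*_ (stable f a) (stable g b)) (splits e) ⟩
  List.map (λ (a , b) → coeff f a * coeff g b) (splits e) ∎)
  where open ≡-Reasoning

⨁ : List Series → Series
⨁ = foldr _⊕_ 𝟘

∏ : List Series → Series
∏ = foldr _⊛_ 𝟙

root : ∀ r .{{_ : NonZero r}} → Exponents m n → Exponents m n
root r = Vec.map (Vec.map (_/ r))

root-pad : ∀ r .{{_ : NonZero r}} (e : Exponents m n) → root r (pad e) ≡ pad (root r e)
root-pad {n = n} r [] = cong (_∷ [])
  (trans (Vec.map-replicate (_/ r) 0 (suc n)) (cong (replicate (suc n)) (0/n≡0 r)))
root-pad r (v ∷ e)    = cong₂ _∷_
  (trans (Vec.map-∷ʳ (_/ r) 0 v) (cong (Vec.map (_/ r) v ∷ʳ_) (0/n≡0 r)))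
  (root-pad r e)

-- Replacing each x_{i,j} by x_{i,j} ^ r.
_[x^_] : Series → ∀ r .{{_ : NonZero r}} → Series
(f [x^ r ]) .coeff  e = if does (allExponents? (r ∣?_) e) then coeff f (root r e) else 0ℚ
(f [x^ r ]) .stable e = cong₂ (if_then_else 0ℚ)
  (does-⇔ (AllExponents-pad (r ∣0) e) (allExponents? (r ∣?_) (pad e)) (allExponents? (r ∣?_) e))
  (trans (cong (coeff f) (root-pad r e)) (stable f (root r e)))

E⁺ : ℕ → Series
E⁺ d .coeff  e = if does (squareFreeOfDegree? d e) then 1ℚ else 0ℚ
E⁺ d .stable e = cong (if_then 1ℚ else 0ℚ) (squareFreeOfDegree-pad d e)

E : ℕ → Series
E d .coeff  e = if does (squareFreeOfDegree? d e) then sign (numIndeterminates e) else 0ℚ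
E d .stable e = cong₂ (if_then_else 0ℚ)
  (squareFreeOfDegree-pad d e) (cong sign (numIndeterminates-pad e))

-- A sequence (α⁽¹⁾ , … , α⁽ⁿ⁾) of lists.  In a polycomposition of n all
-- α⁽ⁱ⁾ with i > n are empty since i |α⁽ⁱ⁾| ≤ n, so nothing is lost by
-- stopping at n.  Beware of the shift: lookup δ i is α⁽ⁱ⁺¹⁾.
ListSeq : ℕ → Set
ListSeq n = Vec (List ℕ) n

IsComposition : List ℕ → Set
IsComposition = ListAll.All NonZero

IsPolycomposition : ListSeq n → Set
IsPolycomposition {n} δ =
  VecAll.All IsComposition δ × weighted 1 (Vec.map sum δ) ≡ n

IsDyadic : ListSeq n → Set
IsDyadic {n} δ = (i : Fin n) → lookup δ i ≢ [] → ∃ λ k → suc (toℕ i) ≡ 2 ^ k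

ℓ : ListSeq n → ℕ
ℓ δ = Vec.sum (Vec.map length δ)

E⁺-block : (d r : ℕ) .{{_ : NonZero r}} → Series
E⁺-block d r = E⁺ d [x^ r ]

E⁺-poly : ListSeq n → Series
E⁺-poly δ = ∏ (concatMap (λ i → List.map (λ d → E⁺-block d (suc (toℕ i))) (lookup δ i))
                         (List.allFin _))

compositions : ℕ → List (List ℕ)
compositions zero    = [] ∷ []
compositions (suc n) = concatMap extend (compositions n)
  module Compositions where
  extend : List ℕ → List (List ℕ)
  extend []      = (1 ∷ []) ∷ []
  extend (a ∷ α) = (1 ∷ a ∷ α) ∷ (suc a ∷ α) ∷ []

vecsOver : List A → ∀ n → List (Vec A n)
vecsOver xs zero    = [] ∷ []
vecsOver xs (suc n) = cartesianProductWith _∷_ xs (vecsOver xs n)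

m<2^m : ∀ m → m < 2 ^ m
m<2^m zero    = s≤s z≤n
m<2^m (suc m) = ℕ.≤-trans (s≤s (m<2^m m)) (ℕ.≤-trans
  (ℕ.+-monoˡ-≤ (2 ^ m) (ℕ.≤-trans (s≤s z≤n) (m<2^m m)))
  (ℕ.≤-reflexive (cong (2 ^ m ℕ.+_) (sym (ℕ.+-identityʳ (2 ^ m))))))

powerOf2? : ∀ m → Dec (∃ λ k → m ≡ 2 ^ k)
powerOf2? m = map′
  (λ (i , q) → toℕ i , q)
  (λ (k , q) → fromℕ< (bound k q) , trans q (cong (2 ^_) (sym (Fin.toℕ-fromℕ< (bound k q)))))
  (Fin.any? {n = m} λ i → m ℕ.≟ 2 ^ toℕ i)
  where
  bound : ∀ k → m ≡ 2 ^ k → k < m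
  bound k q = subst (k <_) (sym q) (m<2^m k)

isDyadic? : Decidable (IsDyadic {n})
isDyadic? δ = Fin.all? λ i →
  ¬? (List.≡-dec ℕ._≟_ (lookup δ i) []) →-dec powerOf2? (suc (toℕ i))

isPolycomposition? : Decidable (IsPolycomposition {n})
isPolycomposition? {n} δ =
  VecAll.all? (ListAll.all? ℕ.nonZero?) δ ×-dec weighted 1 (Vec.map sum δ) ℕ.≟ n

-- The finite set PCom_dyad(d); see ∈-PComDyad and PComDyad-unique.
PComDyad : ∀ d → List (ListSeq d)
PComDyad d = filter (λ δ → isPolycomposition? δ ×-dec isDyadic? δ)
                    (vecsOver (concatMap compositions (upTo (suc d))) d)

open Compositions using (extend)

∈-compositions⁺ : ∀ n {α} → IsComposition α → sum α ≡ n → α ∈ compositions n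
∈-compositions⁺ zero    {[]}              _        _  = here refl
∈-compositions⁺ _       {zero ∷ _}        (() ∷ _) _
∈-compositions⁺ zero    {suc _ ∷ _}       _        ()
∈-compositions⁺ (suc n) {1 ∷ []}          (_ ∷ ps) q  =
  ∈-concatMap⁺ (extend n) (lose (∈-compositions⁺ n ps (ℕ.suc-injective q)) (here refl))
∈-compositions⁺ (suc n) {1 ∷ a ∷ α}       (_ ∷ ps) q  =
  ∈-concatMap⁺ (extend n) (lose (∈-compositions⁺ n ps (ℕ.suc-injective q)) (here refl))
∈-compositions⁺ (suc n) {suc (suc a) ∷ α} (_ ∷ ps) q  =
  ∈-concatMap⁺ (extend n) (lose
    (∈-compositions⁺ n {suc a ∷ α} (_ ∷ ps) (ℕ.suc-injective q)) (there (here refl)))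

extend-sum : ∀ n α {β} → β ∈ extend n α → sum β ≡ suc (sum α)
extend-sum n []      (here refl)         = refl
extend-sum n (a ∷ α) (here refl)         = refl
extend-sum n (a ∷ α) (there (here refl)) = refl

∈-compositions⇒sum : ∀ n {α} → α ∈ compositions n → sum α ≡ n
∈-compositions⇒sum zero    (here refl) = refl
∈-compositions⇒sum (suc n) α∈ with find (∈-concatMap⁻ (extend n) {xs = compositions n} α∈)
... | β , β∈ , α∈′ = trans (extend-sum n β α∈′) (cong suc (∈-compositions⇒sum n β∈))

∈-compositions⇒nonZero : ∀ n {α} → α ∈ compositions n → IsComposition α
∈-compositions⇒nonZero zero    (here refl) = []
∈-compositions⇒nonZero (suc n) α∈ with find (∈-concatMap⁻ (extend n) {xs = compositions n} α∈)
... | []    , β∈ , here refl         = _ ∷ []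
... | b ∷ β , β∈ , here refl         = _ ∷ ∈-compositions⇒nonZero n β∈
... | b ∷ β , β∈ , there (here refl) = _ ∷ ListAll.tail (∈-compositions⇒nonZero n β∈)

concatMap-unique : {f : A → List B} {xs : List A} → Unique xs →
  (∀ {x} → x ∈ xs → Unique (f x)) →
  (∀ {x y v} → x ∈ xs → y ∈ xs → v ∈ f x → v ∈ f y → x ≡ y) →
  Unique (concatMap f xs)
concatMap-unique []         _  _  = []
concatMap-unique {f = f} {x ∷ xs} (x∉ ∷ u) fu fd = Unique.++⁺ (fu (here refl))
  (concatMap-unique u (fu ∘ there) (λ p q → fd (there p) (there q)))
  λ (v∈x , v∈xs) → let y , y∈ , v∈y = find (∈-concatMap⁻ f {xs = xs} v∈xs) in
    ListAll.lookup x∉ y∈ (fd (here refl) (there y∈) v∈x v∈y)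

compositions-unique : ∀ n → Unique (compositions n)
compositions-unique zero    = [] ∷ []
compositions-unique (suc n) = concatMap-unique (compositions-unique n) (unique _) disjoint
  where
  unique : ∀ α → α ∈ compositions n → Unique (extend n α)
  unique []      _  = [] ∷ []
  unique (a ∷ α) α∈ with ListAll.head (∈-compositions⇒nonZero n α∈)
  unique (suc a ∷ α) α∈ | _ = ((λ ()) ∷ []) ∷ [] ∷ []
  disjoint : ∀ {α β γ} → α ∈ compositions n → β ∈ compositions n →
             γ ∈ extend n α → γ ∈ extend n β → α ≡ β
  disjoint {[]}    {[]}    _  _  _                   _                   = refl
  disjoint {a ∷ α} {b ∷ β} _  _  (here refl)         (here refl)         = refl
  disjoint {a ∷ α} {b ∷ β} _  _  (there (here refl)) (there (here refl)) = refl
  disjoint {[]}    {b ∷ β} _  β∈ (here refl)         (there (here refl))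
    with () ∷ _ ← ∈-compositions⇒nonZero n β∈
  disjoint {a ∷ α} {[]}    α∈ _  (there (here refl)) (here refl)
    with () ∷ _ ← ∈-compositions⇒nonZero n α∈
  disjoint {a ∷ α} {b ∷ β} _  β∈ (here refl)         (there (here refl))
    with () ∷ _ ← ∈-compositions⇒nonZero n β∈
  disjoint {a ∷ α} {b ∷ β} α∈ _  (there (here refl)) (here refl)
    with () ∷ _ ← ∈-compositions⇒nonZero n α∈

vecsOver-unique : {xs : List A} → Unique xs → ∀ n → Unique (vecsOver xs n)
vecsOver-unique u zero    = [] ∷ []
vecsOver-unique u (suc n) =
  Unique.cartesianProductWith⁺ _∷_ Vec.∷-injective u (vecsOver-unique u n)

∈-vecsOver⁺ : {xs : List A} {v : Vec A n} → VecAll.All (_∈ xs) v → v ∈ vecsOver xs n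
∈-vecsOver⁺ []       = here refl
∈-vecsOver⁺ (p ∷ ps) = ∈-cartesianProductWith⁺ _∷_ p (∈-vecsOver⁺ ps)

parts∈ : ∀ k d (δ : ListSeq n) → VecAll.All IsComposition δ →
  weighted (suc k) (Vec.map sum δ) ≤ d →
  VecAll.All (_∈ concatMap compositions (upTo (suc d))) δ
parts∈ k d []      _        _  = []
parts∈ k d (α ∷ δ) (p ∷ ps) le =
  ∈-concatMap⁺ compositions (lose
    (∈-upTo⁺ (s≤s (ℕ.≤-trans (ℕ.m≤m+n (sum α) (k ℕ.* sum α)) (ℕ.m+n≤o⇒m≤o _ le))))
    (∈-compositions⁺ _ p refl))
  ∷ parts∈ (suc k) d δ ps (ℕ.m+n≤o⇒n≤o (suc k ℕ.* sum α) le)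

∈-PComDyad : ∀ {d} (δ : ListSeq d) → δ ∈ PComDyad d ⇔ (IsPolycomposition δ × IsDyadic δ)
∈-PComDyad {d} δ = mk⇔
  (λ δ∈ → proj₂ (∈-filter⁻ P? {xs = vecsOver (concatMap compositions (upTo (suc d))) d} δ∈))
  (λ ((c , w) , dy) → ∈-filter⁺ P?
    (∈-vecsOver⁺ (parts∈ 0 d δ c (ℕ.≤-reflexive w))) ((c , w) , dy))
  where
  P? : Decidable (λ (δ : ListSeq d) → IsPolycomposition δ × IsDyadic δ)
  P? δ = isPolycomposition? δ ×-dec isDyadic? δ

PComDyad-unique : ∀ d → Unique (PComDyad d)
PComDyad-unique d = Unique.filter⁺ _ (vecsOver-unique
  (concatMap-unique (Unique.upTo⁺ (suc d)) (λ {s} _ → compositions-unique s)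
    (λ {s} {t} _ _ α∈s α∈t →
      trans (sym (∈-compositions⇒sum s α∈s)) (∈-compositions⇒sum t α∈t)))
  d)

-- Write y for the indeterminates x_{i,j}.  The sum of (-1)^ℓ(α) E⁺_α over all compositions α is
-- the inverse of ∏ (1 + y), by splitting off the first part of α.  Hence the sum over all dyadic
-- polycompositions is ∏_k ∏ (1 + y^(2^k))⁻¹, and this equals ∏ (1 - y) by telescoping
-- (1 + y^r) (1 - y^r) = 1 - y^(2r).  In degree d only multiplicities up to d matter, and since
-- E⁺_δ is homogeneous the weight of δ need not be prescribed when extracting a coefficient.
module Submission where

open import Defs
open import Data.Bool using (Bool; true; false; _∧_; if_then_else_)
open import Data.Fin using (Fin; zero; suc; toℕ)
open import Data.Nat as ℕ using (ℕ; zero; suc; _≤_; _<_; _∸_; _^_; NonZero; z≤n; s≤s)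
import Data.Nat.Properties as ℕ
open import Data.Nat.Divisibility using (_∣_; _∣?_; _∣0; divides; ∣-refl)
open import Data.Nat.DivMod using (_/_; m*n/n≡m; m*[n/m]≡n)
open import Data.Nat.Induction using (<-rec)
open import Data.Nat.ListAction using (sum)
open import Data.Rational using (ℚ; 0ℚ; 1ℚ; _+_; _*_; -_)
import Data.Rational.Properties as ℚ
open import Data.Rational.Solver using (module +-*-Solver)
open import Data.List as List
  using ( List; []; _∷_; _++_; foldr; length; map; upTo; concatMap
        ; cartesianProductWith; filter)
import Data.List.Properties as List
open import Data.List.Membership.Propositional using (_∈_; find)
open import Data.List.Membership.Propositional.Properties
  using (∈-upTo⁻; ∈-map⁻; ∈-concatMap⁻; ∈-cartesianProductWith⁻)
open import Data.List.Relation.Unary.Any using (here; there)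
open import Data.Vec as Vec using (Vec; []; _∷_; lookup)
import Data.Vec.Properties as Vec
open import Data.Vec.Relation.Unary.All as VecAll using ([]; _∷_)
import Data.Vec.Relation.Unary.All.Properties as VecAll
open import Data.Product using (∃; _×_; _,_; proj₁; proj₂)
open import Function using (_∘_; id; mk⇔; Equivalence)
open import Relation.Nullary using (Dec; yes; no; does; ¬_; contradiction; _×-dec_)
open import Relation.Nullary.Decidable using (dec-true; dec-false; does-⇔)
open import Relation.Unary using (Decidable)
open import Relation.Binary.PropositionalEquality

open ≡-Reasoning

-- Products over all indeterminates enter only through their coefficients, as functions `mult φ` on
-- exponent matrices of one fixed size. Such functions are convolved exponent by exponent, so (1 +
-- y^r) (1 - y^r) = 1 - y^(2r) is checked for a single exponent. Division by C = ∏ (1 + y^r) takes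
-- the form of an implication: if C g = f, then the signed sum of E⁺_α f over the compositions α at
-- multiplicity r is g. The telescoping identity supplies each pair f, g in closed form. The
-- multiplicities are therefore treated from the largest down: those above k contribute ∏ (1 -
-- y^(2^j)), where 2^j is the least power of 2 exceeding k, and j drops by one at each power of 2.
-- The sums have a fixed bound D and are evaluated at all monomials of degree at most D: the range
-- of summation must stay the same while convolution passes to divisors of the monomial.

private variable
  A B C : Set
  m n N : ℕ

-- Finite sums of rationals

-- Opaque, so that the summand of a sum can be inferred by unification.
opaque
  ∑ : List A → (A → ℚ) → ℚ
  ∑ xs f = sumℚ (map f xs)

syntax ∑ xs (λ x → t) = ∑[ x ∈ xs ] t

infixr 8 ∑

⟦_⟧ : Bool → ℚ
⟦ b ⟧ = if b then 1ℚ else 0ℚ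

⟦∧⟧ : ∀ b c → ⟦ b ∧ c ⟧ ≡ ⟦ b ⟧ * ⟦ c ⟧
⟦∧⟧ false c = sym (ℚ.*-zeroˡ ⟦ c ⟧)
⟦∧⟧ true  c = sym (ℚ.*-identityˡ ⟦ c ⟧)

opaque
  unfolding ∑

  sumℚ-map : (xs : List A) (f : A → ℚ) → sumℚ (map f xs) ≡ ∑ xs f
  sumℚ-map xs f = refl

  ∑-[] : (f : A → ℚ) → ∑ [] f ≡ 0ℚ
  ∑-[] f = refl

  ∑-∷ : (x : A) (xs : List A) (f : A → ℚ) → ∑ (x ∷ xs) f ≡ f x + ∑ xs f
  ∑-∷ x xs f = refl

  ∑-cong-∈ : {f g : A → ℚ} (xs : List A) → (∀ {x} → x ∈ xs → f x ≡ g x) → ∑ xs f ≡ ∑ xs g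
  ∑-cong-∈ []       eq = refl
  ∑-cong-∈ (x ∷ xs) eq = cong₂ _+_ (eq (here refl)) (∑-cong-∈ xs (eq ∘ there))

  ∑-cong : {f g : A → ℚ} (xs : List A) → (∀ x → f x ≡ g x) → ∑ xs f ≡ ∑ xs g
  ∑-cong xs eq = ∑-cong-∈ xs (λ {x} _ → eq x)

  ∑-0 : (xs : List A) → ∑[ x ∈ xs ] 0ℚ ≡ 0ℚ
  ∑-0 []       = refl
  ∑-0 (x ∷ xs) = trans (ℚ.+-identityˡ _) (∑-0 xs)

  ∑-+ : (xs : List A) (f g : A → ℚ) → ∑[ x ∈ xs ] (f x + g x) ≡ ∑ xs f + ∑ xs g
  ∑-+ []       f g = refl
  ∑-+ (x ∷ xs) f g = trans (cong (f x + g x +_) (∑-+ xs f g))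
    (solve 4 (λ a b c d → (a :+ b) :+ (c :+ d) := (a :+ c) :+ (b :+ d)) refl
      (f x) (g x) (∑ xs f) (∑ xs g))
    where open +-*-Solver

  ∑-*ˡ : (c : ℚ) (xs : List A) (f : A → ℚ) → ∑[ x ∈ xs ] (c * f x) ≡ c * ∑ xs f
  ∑-*ˡ c []       f = sym (ℚ.*-zeroʳ c)
  ∑-*ˡ c (x ∷ xs) f = trans (cong (c * f x +_) (∑-*ˡ c xs f))
    (sym (ℚ.*-distribˡ-+ c (f x) (∑ xs f)))

  ∑-*ʳ : (c : ℚ) (xs : List A) (f : A → ℚ) → ∑[ x ∈ xs ] (f x * c) ≡ ∑ xs f * c
  ∑-*ʳ c xs f = trans (∑-cong xs (λ x → ℚ.*-comm (f x) c))
    (trans (∑-*ˡ c xs f) (ℚ.*-comm c (∑ xs f)))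

  ∑-neg : (xs : List A) (f : A → ℚ) → ∑[ x ∈ xs ] (- f x) ≡ - ∑ xs f
  ∑-neg []       f = refl
  ∑-neg (x ∷ xs) f = trans (cong (- f x +_) (∑-neg xs f)) (sym (ℚ.neg-distrib-+ (f x) (∑ xs f)))

  ∑-swap : (xs : List A) (ys : List B) (f : A → B → ℚ) →
    ∑[ x ∈ xs ] ∑[ y ∈ ys ] f x y ≡ ∑[ y ∈ ys ] ∑[ x ∈ xs ] f x y
  ∑-swap []       ys f = sym (∑-0 ys)
  ∑-swap (x ∷ xs) ys f = trans (cong (∑ ys (f x) +_) (∑-swap xs ys f)) (sym (∑-+ ys (f x) _))

  ∑-++ : (xs ys : List A) (f : A → ℚ) → ∑ (xs ++ ys) f ≡ ∑ xs f + ∑ ys f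
  ∑-++ []       ys f = sym (ℚ.+-identityˡ _)
  ∑-++ (x ∷ xs) ys f = trans (cong (f x +_) (∑-++ xs ys f)) (sym (ℚ.+-assoc (f x) _ _))

  ∑-map : (g : A → B) (xs : List A) (f : B → ℚ) → ∑ (map g xs) f ≡ ∑ xs (f ∘ g)
  ∑-map g xs f = cong sumℚ (sym (List.map-∘ xs))

  ∑-concatMap : (g : A → List B) (xs : List A) (f : B → ℚ) →
    ∑ (concatMap g xs) f ≡ ∑[ x ∈ xs ] ∑ (g x) f
  ∑-concatMap g []       f = refl
  ∑-concatMap g (x ∷ xs) f = trans (∑-++ (g x) _ f) (cong (∑ (g x) f +_) (∑-concatMap g xs f))

  ∑-cartesianProductWith : (h : A → B → C) (xs : List A) (ys : List B) (f : C → ℚ) →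
    ∑ (cartesianProductWith h xs ys) f ≡ ∑[ x ∈ xs ] ∑[ y ∈ ys ] f (h x y)
  ∑-cartesianProductWith h []       ys f = refl
  ∑-cartesianProductWith h (x ∷ xs) ys f = trans (∑-++ (map (h x) ys) _ f)
    (cong₂ _+_ (∑-map (h x) ys f) (∑-cartesianProductWith h xs ys f))

  ∑-upTo : ∀ n (f : ℕ → ℚ) → ∑ (upTo (suc n)) f ≡ f 0 + ∑ (upTo n) (f ∘ suc)
  ∑-upTo n f = trans (cong sumℚ (List.map-upTo f (suc n)))
    (cong (λ ys → f 0 + sumℚ ys) (sym (List.map-upTo (f ∘ suc) n)))

  ∑-filter : {P : A → Set} (P? : Decidable P) (xs : List A) (f : A → ℚ) →
    ∑ (filter P? xs) f ≡ ∑[ x ∈ xs ] (⟦ does (P? x) ⟧ * f x)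
  ∑-filter P? []       f = refl
  ∑-filter P? (x ∷ xs) f with does (P? x)
  ... | true  = cong₂ _+_ (sym (ℚ.*-identityˡ (f x))) (∑-filter P? xs f)
  ... | false = trans (∑-filter P? xs f)
    (sym (trans (cong (_+ _) (ℚ.*-zeroˡ (f x))) (ℚ.+-identityˡ _)))

-- Power series in one indeterminate

⟦_≟_⟧ : ℕ → ℕ → ℚ
⟦ a ≟ b ⟧ = ⟦ does (a ℕ.≟ b) ⟧

∑-upTo-≟ : ∀ {a m} (f : ℕ → ℚ) → a < m → ∑[ i ∈ upTo m ] (⟦ a ≟ i ⟧ * f i) ≡ f a
∑-upTo-≟ {zero}  {suc m} f _        = begin
  ∑[ i ∈ upTo (suc m) ] (⟦ 0 ≟ i ⟧ * f i)            ≡⟨ ∑-upTo m _ ⟩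
  1ℚ * f 0 + ∑[ i ∈ upTo m ] (0ℚ * f (suc i))
    ≡⟨ cong₂ _+_ (ℚ.*-identityˡ (f 0)) (∑-*ˡ 0ℚ (upTo m) (f ∘ suc)) ⟩
  f 0 + 0ℚ * ∑ (upTo m) (f ∘ suc)
    ≡⟨ cong (f 0 +_) (ℚ.*-zeroˡ (∑ (upTo m) (f ∘ suc))) ⟩
  f 0 + 0ℚ                                           ≡⟨ ℚ.+-identityʳ (f 0) ⟩
  f 0                                                ∎
∑-upTo-≟ {suc a} {suc m} f (s≤s lt) = begin
  ∑[ i ∈ upTo (suc m) ] (⟦ suc a ≟ i ⟧ * f i)        ≡⟨ ∑-upTo m _ ⟩
  0ℚ * f 0 + ∑[ i ∈ upTo m ] (⟦ a ≟ i ⟧ * f (suc i))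
    ≡⟨ cong₂ _+_ (ℚ.*-zeroˡ (f 0)) (∑-upTo-≟ (f ∘ suc) lt) ⟩
  0ℚ + f (suc a)                                     ≡⟨ ℚ.+-identityˡ _ ⟩
  f (suc a)                                          ∎

⟦≟⟧-≢ : ∀ a b → a ≢ b → ⟦ a ≟ b ⟧ ≡ 0ℚ
⟦≟⟧-≢ a b a≢b = cong ⟦_⟧ (dec-false (a ℕ.≟ b) a≢b)

-- With `⟦ a ≟_⟧` read as the coefficients of y^a, this is y^a y^b = y^(a+b): only the split with
-- `i = a` can contribute, and it exists when `a ≤ n`.
∑-splitsℕ : ∀ a b n → ∑[ (i , j) ∈ splitsℕ n ] (⟦ a ≟ i ⟧ * ⟦ b ≟ j ⟧) ≡ ⟦ a ℕ.+ b ≟ n ⟧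
∑-splitsℕ a b n with a ℕ.≤? n
... | yes a≤n = begin
  ∑[ (i , j) ∈ splitsℕ n ] (⟦ a ≟ i ⟧ * ⟦ b ≟ j ⟧) ≡⟨ ∑-map (λ i → i , n ∸ i) (upTo (suc n)) _ ⟩
  ∑[ i ∈ upTo (suc n) ] (⟦ a ≟ i ⟧ * ⟦ b ≟ n ∸ i ⟧) ≡⟨ ∑-upTo-≟ _ (s≤s a≤n) ⟩
  ⟦ b ≟ n ∸ a ⟧ ≡⟨ cong ⟦_⟧ (does-⇔ (mk⇔
     (λ b≡ → trans (cong (a ℕ.+_) b≡) (ℕ.m+[n∸m]≡n a≤n))
     (λ a+b≡ → trans (sym (ℕ.m+n∸m≡n a b)) (cong (_∸ a) a+b≡))) (b ℕ.≟ n ∸ a) (a ℕ.+ b ℕ.≟ n)) ⟩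
  ⟦ a ℕ.+ b ≟ n ⟧ ∎
... | no a≰n = begin
  ∑[ (i , j) ∈ splitsℕ n ] (⟦ a ≟ i ⟧ * ⟦ b ≟ j ⟧) ≡⟨ ∑-map (λ i → i , n ∸ i) (upTo (suc n)) _ ⟩
  ∑[ i ∈ upTo (suc n) ] (⟦ a ≟ i ⟧ * ⟦ b ≟ n ∸ i ⟧)
    ≡⟨ ∑-cong-∈ (upTo (suc n)) (λ {i} i∈ → trans
         (cong (_* ⟦ b ≟ n ∸ i ⟧) (⟦≟⟧-≢ a i λ { refl → a≰n (ℕ.≤-pred (∈-upTo⁻ i∈)) }))
         (ℚ.*-zeroˡ ⟦ b ≟ n ∸ i ⟧)) ⟩
  ∑[ i ∈ upTo (suc n) ] 0ℚ ≡⟨ ∑-0 (upTo (suc n)) ⟩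
  0ℚ ≡⟨ ⟦≟⟧-≢ (a ℕ.+ b) n (λ { refl → a≰n (ℕ.m≤m+n a b) }) ⟨
  ⟦ a ℕ.+ b ≟ n ⟧ ∎

-- The coefficients of 1 + y ^ r and 1 - y ^ r.
χ⁺ χ⁻ : ℕ → ℕ → ℚ
χ⁺ r n = ⟦ 0 ≟ n ⟧ + ⟦ r ≟ n ⟧
χ⁻ r n = ⟦ 0 ≟ n ⟧ + - ⟦ r ≟ n ⟧

-- Expanding gives 1 - y^(2r) and the cross terms y^r - y^r, which cancel; `expand` groups the four
-- products so that `difference` evaluates each pair.
χ⁺⊛χ⁻ : ∀ r n → ∑[ (i , j) ∈ splitsℕ n ] (χ⁺ r i * χ⁻ r j) ≡ χ⁻ (r ℕ.+ r) n
χ⁺⊛χ⁻ r n = begin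
  ∑[ (i , j) ∈ splitsℕ n ] (χ⁺ r i * χ⁻ r j)
    ≡⟨ ∑-cong (splitsℕ n) (λ (i , j) → expand ⟦ 0 ≟ i ⟧ ⟦ r ≟ i ⟧ ⟦ 0 ≟ j ⟧ ⟦ r ≟ j ⟧) ⟩
  ∑[ p ∈ splitsℕ n ] ((f 0 0 p + - f r r p) + (f r 0 p + - f 0 r p))
    ≡⟨ ∑-+ (splitsℕ n) _ _ ⟩
  ∑[ p ∈ splitsℕ n ] (f 0 0 p + - f r r p) + ∑[ p ∈ splitsℕ n ] (f r 0 p + - f 0 r p)
    ≡⟨ cong₂ _+_ (difference 0 0 r r) (difference r 0 0 r) ⟩
  χ⁻ (r ℕ.+ r) n + (⟦ r ℕ.+ 0 ≟ n ⟧ + - ⟦ r ≟ n ⟧)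
    ≡⟨ cong (λ a → χ⁻ (r ℕ.+ r) n + (⟦ a ≟ n ⟧ + - ⟦ r ≟ n ⟧)) (ℕ.+-identityʳ r) ⟩
  χ⁻ (r ℕ.+ r) n + (⟦ r ≟ n ⟧ + - ⟦ r ≟ n ⟧)
    ≡⟨ cong (χ⁻ (r ℕ.+ r) n +_) (ℚ.+-inverseʳ ⟦ r ≟ n ⟧) ⟩
  χ⁻ (r ℕ.+ r) n + 0ℚ
    ≡⟨ ℚ.+-identityʳ _ ⟩
  χ⁻ (r ℕ.+ r) n ∎
  where
  f : ℕ → ℕ → ℕ × ℕ → ℚ
  f a b (i , j) = ⟦ a ≟ i ⟧ * ⟦ b ≟ j ⟧
  expand : ∀ x y z w → (x + y) * (z + - w) ≡ (x * z + - (y * w)) + (y * z + - (x * w))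
  expand = solve 4 (λ x y z w → (x :+ y) :* (z :+ :- w)
                             := (x :* z :+ :- (y :* w)) :+ (y :* z :+ :- (x :* w))) refl
    where open +-*-Solver
  difference : ∀ a b a′ b′ → ∑[ p ∈ splitsℕ n ] (f a b p + - f a′ b′ p)
                           ≡ ⟦ a ℕ.+ b ≟ n ⟧ + - ⟦ a′ ℕ.+ b′ ≟ n ⟧
  difference a b a′ b′ = trans (∑-+ (splitsℕ n) (f a b) _)
    (cong₂ _+_ (∑-splitsℕ a b n)
               (trans (∑-neg (splitsℕ n) (f a′ b′)) (cong -_ (∑-splitsℕ a′ b′ n))))

-- Products over the entries of a vector

*-interchange : ∀ a b c d → (a * b) * (c * d) ≡ (a * c) * (b * d)
*-interchange = solve 4 (λ a b c d → (a :* b) :* (c :* d) := (a :* c) :* (b :* d)) refl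
  where open +-*-Solver

prod : (A → ℚ) → Vec A n → ℚ
prod f []       = 1ℚ
prod f (x ∷ xs) = f x * prod f xs

prod-cong-All : {f g : A → ℚ} {xs : Vec A n} →
  VecAll.All (λ x → f x ≡ g x) xs → prod f xs ≡ prod g xs
prod-cong-All []         = refl
prod-cong-All (eq ∷ eqs) = cong₂ _*_ eq (prod-cong-All eqs)

prod-cong : {f g : A → ℚ} → (∀ x → f x ≡ g x) → (xs : Vec A n) → prod f xs ≡ prod g xs
prod-cong eq xs = prod-cong-All (VecAll.universal eq xs)

prod-* : (f g : A → ℚ) (xs : Vec A n) → prod (λ x → f x * g x) xs ≡ prod f xs * prod g xs
prod-* f g []       = refl
prod-* f g (x ∷ xs) = trans (cong (f x * g x *_) (prod-* f g xs))
  (*-interchange (f x) (g x) (prod f xs) (prod g xs))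

prod-map : (f : B → ℚ) (h : A → B) (xs : Vec A n) → prod f (Vec.map h xs) ≡ prod (f ∘ h) xs
prod-map f h []       = refl
prod-map f h (x ∷ xs) = cong (f (h x) *_) (prod-map f h xs)

⟦all?⟧ : {P : A → Set} (P? : Decidable P) (xs : Vec A n) →
  ⟦ does (VecAll.all? P? xs) ⟧ ≡ prod (λ x → ⟦ does (P? x) ⟧) xs
⟦all?⟧ P? []       = refl
⟦all?⟧ P? (x ∷ xs) = trans (⟦∧⟧ (does (P? x)) _) (cong (⟦ does (P? x) ⟧ *_) (⟦all?⟧ P? xs))

-- A split of a vector is an independent choice of a split of each entry, so distributivity turns
-- the sum of products into a product of sums.
∑-splitsVec : (s : A → List (A × A)) (f g : A → ℚ) (xs : Vec A n) →
  ∑[ (as , bs) ∈ splitsVec s xs ] (prod f as * prod g bs)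
  ≡ prod (λ x → ∑[ (a , b) ∈ s x ] (f a * g b)) xs
∑-splitsVec s f g []       = trans (∑-∷ ([] , []) [] _) (trans (cong (1ℚ +_) (∑-[] _)) refl)
∑-splitsVec s f g (x ∷ xs) = begin
  ∑[ (as , bs) ∈ splitsVec s (x ∷ xs) ] (prod f as * prod g bs)
    ≡⟨ ∑-cartesianProductWith ∷-both (s x) (splitsVec s xs) _ ⟩
  ∑[ (a , b) ∈ s x ] ∑[ (as , bs) ∈ splitsVec s xs ] ((f a * prod f as) * (g b * prod g bs))
    ≡⟨ ∑-cong (s x) (λ (a , b) → trans
         (∑-cong (splitsVec s xs) (λ (as , bs) → *-interchange (f a) (prod f as) (g b) (prod g bs)))
         (∑-*ˡ (f a * g b) (splitsVec s xs) _)) ⟩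
  ∑[ (a , b) ∈ s x ] ((f a * g b) * ∑[ (as , bs) ∈ splitsVec s xs ] (prod f as * prod g bs))
    ≡⟨ ∑-*ʳ _ (s x) _ ⟩
  ∑[ (a , b) ∈ s x ] (f a * g b) * ∑[ (as , bs) ∈ splitsVec s xs ] (prod f as * prod g bs)
    ≡⟨ cong (∑[ (a , b) ∈ s x ] (f a * g b) *_) (∑-splitsVec s f g xs) ⟩
  prod (λ x → ∑[ (a , b) ∈ s x ] (f a * g b)) (x ∷ xs) ∎

-- Lifts a left unit from entries to vectors, and by a second application to matrices. As `f` is
-- arbitrary and not a product over the entries, the induction specialises it at the head instead of
-- factoring it.
∑-splitsVec-unitˡ : (s : A → List (A × A)) (u : A → ℚ) →
  (∀ x (f : A → ℚ) → ∑[ (a , b) ∈ s x ] (u a * f b) ≡ f x) →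
  (xs : Vec A n) (f : Vec A n → ℚ) → ∑[ (as , bs) ∈ splitsVec s xs ] (prod u as * f bs) ≡ f xs
∑-splitsVec-unitˡ s u unit []       f = trans (∑-∷ ([] , []) [] _)
  (trans (cong₂ _+_ (ℚ.*-identityˡ (f [])) (∑-[] _)) (ℚ.+-identityʳ (f [])))
∑-splitsVec-unitˡ s u unit (x ∷ xs) f = begin
  ∑[ (as , bs) ∈ splitsVec s (x ∷ xs) ] (prod u as * f bs)
    ≡⟨ ∑-cartesianProductWith ∷-both (s x) (splitsVec s xs) _ ⟩
  ∑[ (a , b) ∈ s x ] ∑[ (as , bs) ∈ splitsVec s xs ] ((u a * prod u as) * f (b ∷ bs))
    ≡⟨ ∑-cong (s x) (λ (a , b) → trans
         (∑-cong (splitsVec s xs) (λ (as , bs) → ℚ.*-assoc (u a) (prod u as) (f (b ∷ bs))))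
         (∑-*ˡ (u a) (splitsVec s xs) _)) ⟩
  ∑[ (a , b) ∈ s x ] (u a * ∑[ (as , bs) ∈ splitsVec s xs ] (prod u as * f (b ∷ bs)))
    ≡⟨ ∑-cong (s x) (λ (a , b) → cong (u a *_) (∑-splitsVec-unitˡ s u unit xs (f ∘ (b ∷_)))) ⟩
  ∑[ (a , b) ∈ s x ] (u a * f (b ∷ xs))
    ≡⟨ unit x (λ b → f (b ∷ xs)) ⟩
  f (x ∷ xs) ∎

-- Convolution of coefficient functions

infixr 7 _✶_

opaque
  -- Taken on plain functions at one size, since `mult φ` and the partial sums below come without a
  -- proof of stability under padding.
  _✶_ : (f g : Exponents m n → ℚ) → Exponents m n → ℚ
  (f ✶ g) e = ∑[ (a , b) ∈ splits e ] (f a * g b)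

  coeff-⊛ : (f g : Series) (e : Monomial N) → coeff (f ⊛ g) e ≡ (coeff f ✶ coeff g) e
  coeff-⊛ f g e = sumℚ-map (splits e) _

  -- Only pairs that split `e` are compared, so that bounds on the degree of `e` reach the factors;
  -- products are compared, so that a vanishing `f a` excuses any difference between `g` and `g′`.
  ✶-cong : {f f′ g g′ : Exponents m n → ℚ} (e : Exponents m n) →
    (∀ {a b} → (a , b) ∈ splits e → f a * g b ≡ f′ a * g′ b) → (f ✶ g) e ≡ (f′ ✶ g′) e
  ✶-cong e eq = ∑-cong-∈ (splits e) eq

  ✶-congˡ : {f f′ g : Exponents m n → ℚ} (e : Exponents m n) →
    (∀ {a b} → (a , b) ∈ splits e → f a ≡ f′ a) → (f ✶ g) e ≡ (f′ ✶ g) e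
  ✶-congˡ {g = g} e eq = ∑-cong-∈ (splits e) (λ {(a , b)} ab∈ → cong (_* g b) (eq ab∈))

  ✶-congʳ : {f g g′ : Exponents m n → ℚ} (e : Exponents m n) →
    (∀ {a b} → (a , b) ∈ splits e → g b ≡ g′ b) → (f ✶ g) e ≡ (f ✶ g′) e
  ✶-congʳ {f = f} e eq = ∑-cong-∈ (splits e) (λ {(a , b)} ab∈ → cong (f a *_) (eq ab∈))

  ✶-zeroʳ : (f : Exponents m n → ℚ) (e : Exponents m n) → (f ✶ (λ _ → 0ℚ)) e ≡ 0ℚ
  ✶-zeroʳ f e = trans (∑-cong (splits e) (λ (a , _) → ℚ.*-zeroʳ (f a))) (∑-0 (splits e))

  ✶-∑ˡ : (xs : List A) (f : A → Exponents m n → ℚ) (g : Exponents m n → ℚ) (e : Exponents m n) →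
    ((λ a → ∑[ x ∈ xs ] f x a) ✶ g) e ≡ ∑[ x ∈ xs ] (f x ✶ g) e
  ✶-∑ˡ xs f g e = trans
    (∑-cong (splits e) (λ (a , b) → sym (∑-*ʳ (g b) xs (λ x → f x a))))
    (∑-swap (splits e) xs _)

  ✶-∑ʳ : (xs : List A) (f : Exponents m n → ℚ) (c : A → ℚ) (g : A → Exponents m n → ℚ)
    (e : Exponents m n) →
    (f ✶ (λ b → ∑[ x ∈ xs ] (c x * g x b))) e ≡ ∑[ x ∈ xs ] (c x * (f ✶ g x) e)
  ✶-∑ʳ xs f c g e = begin
    ∑[ (a , b) ∈ splits e ] (f a * ∑[ x ∈ xs ] (c x * g x b))
      ≡⟨ ∑-cong (splits e) (λ (a , b) → sym (∑-*ˡ (f a) xs _)) ⟩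
    ∑[ (a , b) ∈ splits e ] ∑[ x ∈ xs ] (f a * (c x * g x b))
      ≡⟨ ∑-swap (splits e) xs _ ⟩
    ∑[ x ∈ xs ] ∑[ (a , b) ∈ splits e ] (f a * (c x * g x b))
      ≡⟨ ∑-cong xs (λ x → trans
           (∑-cong (splits e) (λ (a , b) → left-comm (f a) (c x) (g x b)))
           (∑-*ˡ (c x) (splits e) _)) ⟩
    ∑[ x ∈ xs ] (c x * (f ✶ g x) e) ∎
    where
    left-comm : ∀ a b c → a * (b * c) ≡ b * (a * c)
    left-comm = solve 3 (λ a b c → a :* (b :* c) := b :* (a :* c)) refl
      where open +-*-Solver

-- Multiplicative coefficient functions

-- The coefficients of the product over all i, j of Σₙ φ(n) x_{i,j}ⁿ.
mult : (ℕ → ℚ) → Exponents m n → ℚ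
mult φ = prod (prod φ)

mult-cong-All : ∀ {φ ψ} {e : Exponents m n} →
  AllExponents (λ k → φ k ≡ ψ k) e → mult φ e ≡ mult ψ e
mult-cong-All eq = prod-cong-All (VecAll.map prod-cong-All eq)

mult-cong : ∀ {φ ψ} → (∀ k → φ k ≡ ψ k) → (e : Exponents m n) → mult φ e ≡ mult ψ e
mult-cong eq = prod-cong (prod-cong eq)

mult-* : ∀ φ ψ (e : Exponents m n) → mult (λ k → φ k * ψ k) e ≡ mult φ e * mult ψ e
mult-* φ ψ e = trans (prod-cong (prod-* φ ψ) e) (prod-* (prod φ) (prod ψ) e)

mult-map : ∀ φ (h : ℕ → ℕ) (e : Exponents m n) →
  mult φ (Vec.map (Vec.map h) e) ≡ mult (φ ∘ h) e
mult-map φ h e = trans (prod-map (prod φ) (Vec.map h) e) (prod-cong (prod-map φ h) e)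

⟦allExponents?⟧ : {P : ℕ → Set} (P? : Decidable P) (e : Exponents m n) →
  ⟦ does (allExponents? P? e) ⟧ ≡ mult (λ k → ⟦ does (P? k) ⟧) e
⟦allExponents?⟧ P? e = trans (⟦all?⟧ (VecAll.all? P?) e) (prod-cong (⟦all?⟧ P?) e)

opaque
  unfolding _✶_

  mult-✶ : ∀ φ ψ (e : Exponents m n) →
    (mult φ ✶ mult ψ) e ≡ mult (λ k → ∑[ (i , j) ∈ splitsℕ k ] (φ i * ψ j)) e
  mult-✶ φ ψ e = trans (∑-splitsVec (splitsVec splitsℕ) (prod φ) (prod ψ) e)
    (prod-cong (∑-splitsVec splitsℕ φ ψ) e)

  ✶-identityˡ : (f : Exponents m n → ℚ) (e : Exponents m n) → (mult ⟦ 0 ≟_⟧ ✶ f) e ≡ f e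
  ✶-identityˡ f e = ∑-splitsVec-unitˡ (splitsVec splitsℕ) (prod ⟦ 0 ≟_⟧)
    (∑-splitsVec-unitˡ splitsℕ ⟦ 0 ≟_⟧ unit) e f
    where
    unit : ∀ k (f : ℕ → ℚ) → ∑[ (i , j) ∈ splitsℕ k ] (⟦ 0 ≟ i ⟧ * f j) ≡ f k
    unit k f = trans (∑-map (λ i → i , k ∸ i) (upTo (suc k)) _)
      (∑-upTo-≟ (λ i → f (k ∸ i)) (s≤s z≤n))

χ⁺✶χ⁻ : ∀ r (e : Exponents m n) → (mult (χ⁺ r) ✶ mult (χ⁻ r)) e ≡ mult (χ⁻ (r ℕ.+ r)) e
χ⁺✶χ⁻ r e = trans (mult-✶ (χ⁺ r) (χ⁻ r) e) (mult-cong (χ⁺⊛χ⁻ r) e)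

coeff-𝟙 : (e : Monomial N) → coeff 𝟙 e ≡ mult ⟦ 0 ≟_⟧ e
coeff-𝟙 e = trans (⟦allExponents?⟧ (ℕ._≟ 0) e)
  (mult-cong (λ { zero → refl ; (suc _) → refl }) e)

-- Degrees of factors and of roots

splitsℕ-+ : ∀ {k i j} → (i , j) ∈ splitsℕ k → i ℕ.+ j ≡ k
splitsℕ-+ {k} ij∈ with ∈-map⁻ (λ i → i , k ∸ i) ij∈
... | i , i∈ , refl = ℕ.m+[n∸m]≡n (ℕ.≤-pred (∈-upTo⁻ i∈))

module _ (s : A → List (A × A)) (h : A → ℕ)
         (h-+ : ∀ {x a b} → (a , b) ∈ s x → h a ℕ.+ h b ≡ h x) where
  splitsVec-sum : (xs : Vec A n) {as bs : Vec A n} → (as , bs) ∈ splitsVec s xs →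
    Vec.sum (Vec.map h as) ℕ.+ Vec.sum (Vec.map h bs) ≡ Vec.sum (Vec.map h xs)
  splitsVec-sum []       (here refl) = refl
  splitsVec-sum (x ∷ xs) p with ∈-cartesianProductWith⁻ ∷-both (s x) (splitsVec s xs) p
  ... | (a , b) , (as , bs) , ab∈ , p′ , refl = trans
    (interchange (h a) _ (h b) _) (cong₂ ℕ._+_ (h-+ ab∈) (splitsVec-sum xs p′))
    where open import Algebra.Properties.CommutativeSemigroup ℕ.+-commutativeSemigroup

  splitsVec-weighted : ∀ k (xs : Vec A n) {as bs : Vec A n} → (as , bs) ∈ splitsVec s xs →
    weighted k (Vec.map h as) ℕ.+ weighted k (Vec.map h bs) ≡ weighted k (Vec.map h xs)
  splitsVec-weighted k []       (here refl) = refl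
  splitsVec-weighted k (x ∷ xs) p with ∈-cartesianProductWith⁻ ∷-both (s x) (splitsVec s xs) p
  ... | (a , b) , (as , bs) , ab∈ , p′ , refl = trans (interchange (k ℕ.* h a) _ (k ℕ.* h b) _)
    (cong₂ ℕ._+_ (trans (sym (ℕ.*-distribˡ-+ k (h a) (h b))) (cong (k ℕ.*_) (h-+ ab∈)))
                 (splitsVec-weighted (suc k) xs p′))
    where open import Algebra.Properties.CommutativeSemigroup ℕ.+-commutativeSemigroup

degree-splits : (e : Exponents m n) {a b : Exponents m n} → (a , b) ∈ splits e →
  degree a ℕ.+ degree b ≡ degree e
degree-splits e = splitsVec-weighted (splitsVec splitsℕ) Vec.sum
  -- `splitsVec-sum` measures entries through `Vec.map h`; here `h = id`, and `Vec.map-id` removes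
  -- the map.
  (λ {v} {v₁} {v₂} p → trans
    (sym (cong₂ ℕ._+_ (cong Vec.sum (Vec.map-id v₁)) (cong Vec.sum (Vec.map-id v₂))))
    (trans (splitsVec-sum splitsℕ id splitsℕ-+ v p) (cong Vec.sum (Vec.map-id v)))) 1 e

sum-entries : ∀ {D} (v : Vec ℕ n) → Vec.sum v ≤ D → VecAll.All (_≤ D) v
sum-entries []      _  = []
sum-entries (x ∷ v) le = ℕ.m+n≤o⇒m≤o x le ∷ sum-entries v (ℕ.m+n≤o⇒n≤o x le)

weighted-entries : ∀ k {D} (v : Vec ℕ n) → weighted (suc k) v ≤ D → VecAll.All (_≤ D) v
weighted-entries k []      _  = []
weighted-entries k (x ∷ v) le =
  ℕ.≤-trans (ℕ.m≤m+n x (k ℕ.* x)) (ℕ.m+n≤o⇒m≤o (suc k ℕ.* x) le)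
  ∷ weighted-entries (suc k) v (ℕ.m+n≤o⇒n≤o (suc k ℕ.* x) le)

-- Every indeterminate has degree at least 1, so its exponent is at most its contribution to the
-- degree.
degree-entries : (e : Exponents m n) → AllExponents (_≤ degree e) e
degree-entries e = VecAll.map (λ {v} → sum-entries v)
  (VecAll.map⁻ (weighted-entries 0 (Vec.map Vec.sum e) ℕ.≤-refl))

sum-/ : ∀ r .{{_ : NonZero r}} {v : Vec ℕ n} → VecAll.All (r ∣_) v →
  Vec.sum v ≡ r ℕ.* Vec.sum (Vec.map (_/ r) v)
sum-/ r []       = sym (ℕ.*-zeroʳ r)
sum-/ r (p ∷ ps) = trans (cong₂ ℕ._+_ (sym (m*[n/m]≡n p)) (sum-/ r ps))
  (sym (ℕ.*-distribˡ-+ r _ _))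

weighted-root : ∀ r .{{_ : NonZero r}} k {e : Exponents m n} → AllExponents (r ∣_) e →
  weighted k (Vec.map Vec.sum e) ≡ r ℕ.* weighted k (Vec.map Vec.sum (root r e))
weighted-root r k []       = sym (ℕ.*-zeroʳ r)
weighted-root r k (p ∷ ps) = trans
  (cong₂ ℕ._+_ (trans (cong (k ℕ.*_) (sum-/ r p)) (x∙yz≈y∙xz k r _)) (weighted-root r (suc k) ps))
  (sym (ℕ.*-distribˡ-+ r _ _))
  where open import Algebra.Properties.CommutativeSemigroup ℕ.*-commutativeSemigroup

degree-root : ∀ r .{{_ : NonZero r}} {e : Exponents m n} → AllExponents (r ∣_) e →
  degree e ≡ r ℕ.* degree (root r e)
degree-root r = weighted-root r 1

sum-0 : {v : Vec ℕ n} → VecAll.All (_≡ 0) v → Vec.sum v ≡ 0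
sum-0 []          = refl
sum-0 (refl ∷ ps) = sum-0 ps

weighted-0 : ∀ k {v : Vec ℕ n} → VecAll.All (_≡ 0) v → weighted k v ≡ 0
weighted-0 k []          = refl
weighted-0 k (refl ∷ ps) = cong₂ ℕ._+_ (ℕ.*-zeroʳ k) (weighted-0 (suc k) ps)

degree-0 : {e : Exponents m n} → AllExponents (_≡ 0) e → degree e ≡ 0
degree-0 ps = weighted-0 1 (VecAll.map⁺ (VecAll.map sum-0 ps))

-- Blocks of a fixed multiplicity

-- y ^ k is a monomial of 1 + y ^ r iff r divides k and y ^ (k / r) is square-free.
χ⁺-root : ∀ q k → ⟦ does (suc q ∣? k) ⟧ * ⟦ does (k / suc q ℕ.≤? 1) ⟧ ≡ χ⁺ (suc q) k
χ⁺-root q k = lemma (suc q ∣? k)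
  where
  small : ∀ p → 1ℚ * ⟦ does (p ℕ.≤? 1) ⟧ ≡ χ⁺ (suc q) (p ℕ.* suc q)
  small 0             = refl
  small 1             = cong (λ i → 0ℚ + ⟦ i ⟧)
    (sym (dec-true (suc q ℕ.≟ 1 ℕ.* suc q) (sym (ℕ.*-identityˡ (suc q)))))
  -- Twice `suc q` or more exceeds `suc q`, so the exponent belongs to neither term.
  small (suc (suc p)) = cong (0ℚ +_)
    (sym (⟦≟⟧-≢ (suc q) (suc (suc p) ℕ.* suc q) (ℕ.m≢1+m+n (suc q) ∘ λ eq →
      trans eq (cong suc (ℕ.+-suc q _)))))
  lemma : Dec (suc q ∣ k) → ⟦ does (suc q ∣? k) ⟧ * ⟦ does (k / suc q ℕ.≤? 1) ⟧ ≡ χ⁺ (suc q) k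
  lemma (no r∤k) = begin
    ⟦ does (suc q ∣? k) ⟧ * ⟦ does (k / suc q ℕ.≤? 1) ⟧
      ≡⟨ cong (λ b → ⟦ b ⟧ * ⟦ does (k / suc q ℕ.≤? 1) ⟧) (dec-false (suc q ∣? k) r∤k) ⟩
    0ℚ * ⟦ does (k / suc q ℕ.≤? 1) ⟧
      ≡⟨ ℚ.*-zeroˡ ⟦ does (k / suc q ℕ.≤? 1) ⟧ ⟩
    0ℚ + 0ℚ
      ≡⟨ cong₂ _+_ (⟦≟⟧-≢ 0 k λ { refl → r∤k (suc q ∣0) })
                   (⟦≟⟧-≢ (suc q) k λ { refl → r∤k ∣-refl }) ⟨
    χ⁺ (suc q) k ∎
  lemma (yes r∣k@(divides p refl)) = begin
    ⟦ does (suc q ∣? k) ⟧ * ⟦ does (k / suc q ℕ.≤? 1) ⟧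
      ≡⟨ cong₂ (λ b i → ⟦ b ⟧ * ⟦ does (i ℕ.≤? 1) ⟧)
           (dec-true (suc q ∣? k) r∣k) (m*n/n≡m p (suc q)) ⟩
    1ℚ * ⟦ does (p ℕ.≤? 1) ⟧
      ≡⟨ small p ⟩
    χ⁺ (suc q) k ∎

module _ (q : ℕ) where
  private
    r : ℕ
    r = suc q

  mult-χ⁺ : (e : Exponents m n) →
    ⟦ does (allExponents? (r ∣?_) e) ⟧ * ⟦ does (allExponents? (ℕ._≤? 1) (root r e)) ⟧
    ≡ mult (χ⁺ r) e
  mult-χ⁺ e = begin
    ⟦ does (allExponents? (r ∣?_) e) ⟧ * ⟦ does (allExponents? (ℕ._≤? 1) (root r e)) ⟧
      ≡⟨ cong₂ _*_ (⟦allExponents?⟧ (r ∣?_) e)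
           (trans (⟦allExponents?⟧ (ℕ._≤? 1) (root r e)) (mult-map _ (_/ r) e)) ⟩
    mult (λ k → ⟦ does (r ∣? k) ⟧) e * mult (λ k → ⟦ does (k / r ℕ.≤? 1) ⟧) e
      ≡⟨ mult-* _ _ e ⟨
    mult (λ k → ⟦ does (r ∣? k) ⟧ * ⟦ does (k / r ℕ.≤? 1) ⟧) e
      ≡⟨ mult-cong (χ⁺-root q) e ⟩
    mult (χ⁺ r) e ∎

  E⁺-block-homogeneous : ∀ a (e : Monomial N) → degree e ≢ r ℕ.* a →
    coeff (E⁺-block a r) e ≡ 0ℚ
  E⁺-block-homogeneous a e deg≢ with allExponents? (r ∣?_) e
  ... | no _ = refl
  ... | yes r∣e = cong ⟦_⟧ (dec-false (squareFreeOfDegree? a (root r e))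
    (λ (_ , eq) → deg≢ (trans (degree-root r r∣e) (cong (r ℕ.*_) eq))))

  -- The only monomial of degree 0 is 1. This is the summand that isolates `g` in the recursion of
  -- `∑-act`.
  E⁺-block-0 : (e : Monomial N) → coeff (E⁺-block 0 r) e ≡ mult ⟦ 0 ≟_⟧ e
  E⁺-block-0 e = trans (lemma (degree e ℕ.≟ 0)) (coeff-𝟙 e)
    where
    zeros : degree e ≡ 0 → AllExponents (_≡ 0) e
    zeros eq = VecAll.map (VecAll.map (λ le → ℕ.n≤0⇒n≡0 (ℕ.≤-trans le (ℕ.≤-reflexive eq))))
      (degree-entries e)
    lemma : Dec (degree e ≡ 0) → coeff (E⁺-block 0 r) e ≡ coeff 𝟙 e
    lemma (no deg≢0) = trans
      (E⁺-block-homogeneous 0 e (λ eq → deg≢0 (trans eq (ℕ.*-zeroʳ r))))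
      (cong ⟦_⟧ (sym (dec-false (allExponents? (ℕ._≟ 0) e) (deg≢0 ∘ degree-0))))
    lemma (yes deg≡0) = trans
      (cong₂ (λ b c → if b then ⟦ c ⟧ else 0ℚ)
        (dec-true (allExponents? (r ∣?_) e) r∣e)
        (dec-true (squareFreeOfDegree? 0 (root r e)) (squareFree , ℕ.*-cancelˡ-≡ _ 0 r
          (trans (sym (degree-root r r∣e)) (trans deg≡0 (sym (ℕ.*-zeroʳ r)))))))
      (cong ⟦_⟧ (sym (dec-true (allExponents? (ℕ._≟ 0) e) (zeros deg≡0))))
      where
      r∣e : AllExponents (r ∣_) e
      r∣e = VecAll.map (VecAll.map λ { refl → r ∣0 }) (zeros deg≡0)
      squareFree : SquareFree (root r e)
      squareFree = VecAll.map⁺ (VecAll.map (λ ps → VecAll.map⁺ (VecAll.map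
        (λ { refl → z≤n }) ps)) (zeros deg≡0))

  -- If `e` has a square-free root, exactly one `a` counts it, namely the degree of that root; it is
  -- at most `degree e`, so the range up to `D` contains it.
  ∑-E⁺-block : ∀ {D} (e : Monomial N) → degree e ≤ D →
    ∑[ a ∈ upTo (suc D) ] coeff (E⁺-block a r) e ≡ mult (χ⁺ r) e
  ∑-E⁺-block {D = D} e le = trans lemma (mult-χ⁺ e)
    where
    squareFree : Bool
    squareFree = does (allExponents? (ℕ._≤? 1) (root r e))
    lemma : ∑[ a ∈ upTo (suc D) ] coeff (E⁺-block a r) e
      ≡ ⟦ does (allExponents? (r ∣?_) e) ⟧ * ⟦ squareFree ⟧
    lemma with allExponents? (r ∣?_) e
    ... | no _ = trans (∑-0 (upTo (suc D))) (sym (ℚ.*-zeroˡ ⟦ squareFree ⟧))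
    ... | yes r∣e = begin
      ∑[ a ∈ upTo (suc D) ] coeff (E⁺ a) (root r e)
        ≡⟨ ∑-cong (upTo (suc D)) (λ a → trans (⟦∧⟧ squareFree _)
             (ℚ.*-comm ⟦ squareFree ⟧ ⟦ degree (root r e) ≟ a ⟧)) ⟩
      ∑[ a ∈ upTo (suc D) ] (⟦ degree (root r e) ≟ a ⟧ * ⟦ squareFree ⟧)
        ≡⟨ ∑-upTo-≟ {degree (root r e)} (λ _ → ⟦ squareFree ⟧) (s≤s (ℕ.≤-trans
             (ℕ.≤-trans (ℕ.m≤m+n _ (q ℕ.* degree (root r e)))
               (ℕ.≤-reflexive (sym (degree-root r r∣e)))) le)) ⟩
      ⟦ squareFree ⟧
        ≡⟨ ℚ.*-identityˡ ⟦ squareFree ⟧ ⟨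
      1ℚ * ⟦ squareFree ⟧ ∎

  -- The blocks with parts `α` times `f`, bracketed as in `∏`, so that `f` stays the innermost
  -- factor.
  act : (Monomial N → ℚ) → List ℕ → Monomial N → ℚ
  act = foldr (λ a f → coeff (E⁺-block a r) ✶ f)

  coeff-∏-++ : ∀ α (fs : List Series) (e : Monomial N) →
    coeff (∏ (map (λ a → E⁺-block a r) α ++ fs)) e ≡ act (coeff (∏ fs)) α e
  coeff-∏-++ []      fs e = refl
  coeff-∏-++ (a ∷ α) fs e = trans
    (coeff-⊛ (E⁺-block a r) (∏ (map (λ a → E⁺-block a r) α ++ fs)) e)
    (✶-congʳ e (λ {_} {b} _ → coeff-∏-++ α fs b))

  -- The coefficient at `e` involves `f` only at divisors of `e`, whose degrees are no larger.
  act-cong : ∀ {D} {f g : Monomial N → ℚ} → (∀ e → degree e ≤ D → f e ≡ g e) →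
    ∀ α e → degree e ≤ D → act f α e ≡ act g α e
  act-cong eq []      e le = eq e le
  act-cong eq (a ∷ α) e le = ✶-congʳ e (λ {b} {c} bc∈ →
    act-cong eq α c (ℕ.≤-trans (ℕ.m≤n+m (degree c) (degree b))
      (ℕ.≤-trans (ℕ.≤-reflexive (degree-splits e bc∈)) le)))

  act-∑ : (xs : List A) (c : A → ℚ) (f : A → Monomial N → ℚ) → ∀ α e →
    act (λ b → ∑[ x ∈ xs ] (c x * f x b)) α e ≡ ∑[ x ∈ xs ] (c x * act (f x) α e)
  act-∑ xs c f []      e = refl
  act-∑ xs c f (a ∷ α) e = trans
    (✶-congʳ e (λ {_} {b} _ → act-∑ xs c f α b))
    (✶-∑ʳ xs (coeff (E⁺-block a r)) c (λ x → act (f x) α) e)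

  -- Homogeneity of the block determines the degree of the cofactor. For `a > 0` this degree is
  -- strictly smaller, which drives the recursion in `∑-act`.
  E⁺-block-✶-cong : ∀ a {f g : Monomial N → ℚ} (e : Monomial N) →
    (∀ {b} → r ℕ.* a ℕ.+ degree b ≡ degree e → f b ≡ g b) →
    (coeff (E⁺-block a r) ✶ f) e ≡ (coeff (E⁺-block a r) ✶ g) e
  E⁺-block-✶-cong a {f} {g} e eq = ✶-cong {f′ = coeff (E⁺-block a r)} {g′ = g} e λ {b} {c} bc∈ →
    lemma b c (degree-splits e bc∈) (degree b ℕ.≟ r ℕ.* a)
    where
    lemma : ∀ b c → degree b ℕ.+ degree c ≡ degree e → Dec (degree b ≡ r ℕ.* a) →
      coeff (E⁺-block a r) b * f c ≡ coeff (E⁺-block a r) b * g c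
    lemma b c deg (yes p) = cong (coeff (E⁺-block a r) b *_)
      (eq (trans (cong (ℕ._+ degree c) (sym p)) deg))
    lemma b c deg (no ¬p) = trans (zero* (f c)) (sym (zero* (g c)))
      where
      zero* : ∀ y → coeff (E⁺-block a r) b * y ≡ 0ℚ
      zero* y = trans (cong (_* y) (E⁺-block-homogeneous a b ¬p)) (ℚ.*-zeroˡ y)

  act-homogeneous : ∀ {w} {f : Monomial N → ℚ} → (∀ e → degree e ≢ w → f e ≡ 0ℚ) →
    ∀ α e → degree e ≢ r ℕ.* sum α ℕ.+ w → act f α e ≡ 0ℚ
  act-homogeneous {w = w} hom []      e deg≢ = hom e (λ eq → deg≢ (trans eq
    (cong (ℕ._+ w) (sym (ℕ.*-zeroʳ r)))))
  act-homogeneous {w = w} hom (a ∷ α) e deg≢ = trans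
    (E⁺-block-✶-cong a {g = λ _ → 0ℚ} e (λ {b} deg → act-homogeneous hom α b (λ eq → deg≢ (begin
      degree e                                  ≡⟨ deg ⟨
      r ℕ.* a ℕ.+ degree b                      ≡⟨ cong (r ℕ.* a ℕ.+_) eq ⟩
      r ℕ.* a ℕ.+ (r ℕ.* sum α ℕ.+ w)           ≡⟨ ℕ.+-assoc (r ℕ.* a) _ w ⟨
      r ℕ.* a ℕ.+ r ℕ.* sum α ℕ.+ w             ≡⟨ cong (ℕ._+ w) (ℕ.*-distribˡ-+ r a (sum α)) ⟨
      r ℕ.* sum (a ∷ α) ℕ.+ w                   ∎))))
    (✶-zeroʳ (coeff (E⁺-block a r)) e)

-- Splitting off the first part of a composition

open Compositions using (extend)

-- For `D = d` the list from which `PComDyad d` draws its entries.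
compositions≤ : ℕ → List (List ℕ)
compositions≤ D = concatMap compositions (upTo (suc D))

-- The second alternative in `extend`; `[]` has only one extension, hence the value 0.
incrementHead : (List ℕ → ℚ) → List ℕ → ℚ
incrementHead f []      = 0ℚ
incrementHead f (a ∷ α) = f (suc a ∷ α)

∑-compositions : ∀ n (f : List ℕ → ℚ) → ∑ (compositions (suc n)) f
  ≡ ∑ (compositions n) (f ∘ (1 ∷_)) + ∑ (compositions n) (incrementHead f)
∑-compositions n f = trans (∑-concatMap (extend n) (compositions n) f)
  (trans (∑-cong (compositions n) ∑-extend) (∑-+ (compositions n) _ _))
  where
  ∑-extend : ∀ α → ∑ (extend n α) f ≡ f (1 ∷ α) + incrementHead f α
  ∑-extend []      = trans (∑-∷ _ _ f) (cong (f (1 ∷ []) +_) (∑-[] f))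
  ∑-extend (a ∷ α) = trans (∑-∷ _ _ f) (cong (f (1 ∷ a ∷ α) +_)
    (trans (∑-∷ _ _ f) (trans (cong (f (suc a ∷ α) +_) (∑-[] f)) (ℚ.+-identityʳ _))))

∑-compositions≤ : ∀ D (f : List ℕ → ℚ) → ∑ (compositions≤ D) f
  ≡ f [] + ∑[ k ∈ upTo D ] ∑ (compositions≤ (D ∸ suc k)) (f ∘ (suc k ∷_))
∑-compositions≤ zero    f = trans (∑-∷ [] [] f) (cong (f [] +_) (trans (∑-[] f) (sym (∑-[] _))))
∑-compositions≤ (suc D) f = begin
  ∑ (compositions≤ (suc D)) f
    ≡⟨ ∑-concatMap compositions (upTo (suc (suc D))) f ⟩
  ∑[ n ∈ upTo (suc (suc D)) ] ∑ (compositions n) f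
    ≡⟨ ∑-upTo (suc D) _ ⟩
  ∑ (compositions 0) f + ∑[ n ∈ upTo (suc D) ] ∑ (compositions (suc n)) f
    ≡⟨ cong₂ _+_ (trans (∑-∷ [] [] f) (trans (cong (f [] +_) (∑-[] f)) (ℚ.+-identityʳ (f []))))
         (trans (∑-cong (upTo (suc D)) (λ n → ∑-compositions n f)) (∑-+ (upTo (suc D)) _ _)) ⟩
  f [] + (∑[ n ∈ upTo (suc D) ] ∑ (compositions n) (f ∘ (1 ∷_))
          + ∑[ n ∈ upTo (suc D) ] ∑ (compositions n) (incrementHead f))
    ≡⟨ cong (f [] +_) (cong₂ _+_ (∑-concatMap compositions (upTo (suc D)) _)
                                 (∑-concatMap compositions (upTo (suc D)) _)) ⟨
  f [] + (∑ (compositions≤ D) (f ∘ (1 ∷_)) + ∑ (compositions≤ D) (incrementHead f))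
    -- A first part of at least 2 comes from incrementing, so the induction hypothesis is applied to
    -- `incrementHead f`, whose value at `[]` is 0.
    ≡⟨ cong (λ t → f [] + (∑ (compositions≤ D) (f ∘ (1 ∷_)) + t))
         (trans (∑-compositions≤ D (incrementHead f)) (ℚ.+-identityˡ _)) ⟩
  f [] + (∑ (compositions≤ D) (f ∘ (1 ∷_))
          + ∑[ k ∈ upTo D ] ∑ (compositions≤ (D ∸ suc k)) (f ∘ (suc (suc k) ∷_)))
    ≡⟨ cong (f [] +_) (∑-upTo D _) ⟨
  f [] + ∑[ k ∈ upTo (suc D) ] ∑ (compositions≤ (suc D ∸ suc k)) (f ∘ (suc k ∷_)) ∎

-- In degrees ≤ D the sum is f divided by ∏ (1 + y^(q+1)): splitting off the first part of α
-- turns the hypothesis into a recursion.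
∑-act : ∀ q {f g : Monomial N → ℚ} → (∀ e → (mult (χ⁺ (suc q)) ✶ g) e ≡ f e) →
  ∀ D e → degree e ≤ D →
  ∑[ α ∈ compositions≤ D ] (sign (length α) * act q f α e) ≡ g e
∑-act {N} q {f} {g} C✶g≡f = <-rec P step
  where
  P : ℕ → Set
  P D = (e : Monomial N) → degree e ≤ D →
    ∑[ α ∈ compositions≤ D ] (sign (length α) * act q f α e) ≡ g e

  E⁺ʳ : ℕ → Monomial N → ℚ
  E⁺ʳ a = coeff (E⁺-block a (suc q))

  step : ∀ D → (∀ {D′} → D′ < D → P D′) → P D
  step D rec e le = begin
    ∑[ α ∈ compositions≤ D ] (sign (length α) * act q f α e)
      ≡⟨ ∑-compositions≤ D _ ⟩
    1ℚ * f e + ∑[ k ∈ upTo D ] ∑[ α ∈ compositions≤ (D ∸ suc k) ]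
                 (- sign (length α) * (E⁺ʳ (suc k) ✶ act q f α) e)
      ≡⟨ cong₂ _+_ (trans (ℚ.*-identityˡ (f e)) f≡)
           (trans (∑-cong-∈ (upTo D) (λ {k} k∈ → part k (∈-upTo⁻ k∈)))
                  (∑-neg (upTo D) (λ k → (E⁺ʳ (suc k) ✶ g) e))) ⟩
    (g e + rest) + - rest
      ≡⟨ ℚ.+-assoc (g e) rest (- rest) ⟩
    g e + (rest + - rest)
      ≡⟨ cong (g e +_) (ℚ.+-inverseʳ rest) ⟩
    g e + 0ℚ
      ≡⟨ ℚ.+-identityʳ (g e) ⟩
    g e ∎
    where
    rest : ℚ
    rest = ∑[ k ∈ upTo D ] (E⁺ʳ (suc k) ✶ g) e

    -- The term of block degree 0 in C g = f is `g` itself; the nonempty compositions will cancel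
    -- `rest`.
    f≡ : f e ≡ g e + rest
    f≡ = begin
      f e
        ≡⟨ C✶g≡f e ⟨
      (mult (χ⁺ (suc q)) ✶ g) e
        ≡⟨ ✶-congˡ e (λ {a} {b} ab∈ → ∑-E⁺-block q a (ℕ.≤-trans
             (ℕ.≤-trans (ℕ.m≤m+n _ (degree b)) (ℕ.≤-reflexive (degree-splits e ab∈))) le)) ⟨
      ((λ a → ∑[ k ∈ upTo (suc D) ] E⁺ʳ k a) ✶ g) e
        ≡⟨ ✶-∑ˡ (upTo (suc D)) E⁺ʳ g e ⟩
      ∑[ k ∈ upTo (suc D) ] (E⁺ʳ k ✶ g) e
        ≡⟨ ∑-upTo D _ ⟩
      (E⁺ʳ 0 ✶ g) e + rest
        ≡⟨ cong (_+ rest) (trans (✶-congˡ e (λ {a} _ → E⁺-block-0 q a))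
                                 (✶-identityˡ g e)) ⟩
      g e + rest ∎

    part : ∀ k → k < D → ∑[ α ∈ compositions≤ (D ∸ suc k) ]
             (- sign (length α) * (E⁺ʳ (suc k) ✶ act q f α) e) ≡ - (E⁺ʳ (suc k) ✶ g) e
    part k k<D = begin
      ∑[ α ∈ compositions≤ (D ∸ suc k) ] (- sign (length α) * (E⁺ʳ (suc k) ✶ act q f α) e)
        ≡⟨ ∑-cong _ (λ α → sym (ℚ.neg-distribˡ-* (sign (length α)) _)) ⟩
      ∑[ α ∈ compositions≤ (D ∸ suc k) ] (- (sign (length α) * (E⁺ʳ (suc k) ✶ act q f α) e))
        ≡⟨ ∑-neg (compositions≤ (D ∸ suc k)) _ ⟩
      - ∑[ α ∈ compositions≤ (D ∸ suc k) ] (sign (length α) * (E⁺ʳ (suc k) ✶ act q f α) e)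
        ≡⟨ cong -_ (✶-∑ʳ (compositions≤ (D ∸ suc k)) (E⁺ʳ (suc k)) (sign ∘ length) (act q f) e) ⟨
      - (E⁺ʳ (suc k) ✶ (λ b → ∑[ α ∈ compositions≤ (D ∸ suc k) ] (sign (length α) * act q f α b))) e
        -- The block has degree `suc q * suc k`, at least `suc k`, so its cofactors have degree at
        -- most `D ∸ suc k`, where the claim is known.
        ≡⟨ cong -_ (E⁺-block-✶-cong q (suc k) e (λ {b} deg →
             rec (ℕ.∸-monoʳ-< (s≤s z≤n) k<D) b (bound b deg))) ⟩
      - (E⁺ʳ (suc k) ✶ g) e ∎
      where
      bound : ∀ b → suc q ℕ.* suc k ℕ.+ degree b ≡ degree e → degree b ≤ D ∸ suc k
      bound b deg = ℕ.m+n≤o⇒m≤o∸n (degree b) (ℕ.≤-trans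
        (ℕ.≤-reflexive (ℕ.+-comm (degree b) (suc k))) (ℕ.≤-trans
        (ℕ.+-monoˡ-≤ (degree b) (ℕ.m≤m+n (suc k) (q ℕ.* suc k)))
        (ℕ.≤-trans (ℕ.≤-reflexive deg) le)))

-- Polycompositions entry by entry

-- Unlike in E⁺-poly, the first entry of δ has multiplicity suc k, so that one can recurse on δ.
blocks : ℕ → ListSeq n → List Series
blocks k []      = []
blocks k (α ∷ δ) = map (λ a → E⁺-block a (suc k)) α ++ blocks (suc k) δ

-- A general `μ` makes the induction go through: passing to the tail replaces `μ` by `μ ∘ suc`.
concatMap-E⁺-block : ∀ k (μ : Fin n → ℕ) → (∀ i → μ i ≡ k ℕ.+ toℕ i) → (δ : ListSeq n) →
  concatMap (λ i → map (λ a → E⁺-block a (suc (μ i))) (lookup δ i)) (List.allFin n) ≡ blocks k δ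
concatMap-E⁺-block k μ μ≡ []      = refl
concatMap-E⁺-block {suc n} k μ μ≡ (α ∷ δ) = cong₂ _++_
  (cong (λ i → map (λ a → E⁺-block a (suc i)) α) (trans (μ≡ zero) (ℕ.+-identityʳ k)))
  (begin
    concatMap block (List.tabulate suc)
      ≡⟨ cong (concatMap block) (List.map-tabulate id suc) ⟨
    concatMap block (map suc (List.allFin n))
      ≡⟨ List.concatMap-map block suc (List.allFin n) ⟩
    concatMap (block ∘ suc) (List.allFin n)
      ≡⟨ concatMap-E⁺-block (suc k) (μ ∘ suc) (λ i → trans (μ≡ (suc i)) (ℕ.+-suc k (toℕ i))) δ ⟩
    blocks (suc k) δ ∎)
  where
  block : Fin (suc n) → List Series
  block i = map (λ a → E⁺-block a (suc (μ i))) (lookup (α ∷ δ) i)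

E⁺-poly-blocks : (δ : ListSeq n) → E⁺-poly δ ≡ ∏ (blocks 0 δ)
E⁺-poly-blocks δ = cong ∏ (concatMap-E⁺-block 0 toℕ (λ _ → refl) δ)

blocks-homogeneous : ∀ k (δ : ListSeq n) (e : Monomial N) →
  degree e ≢ weighted (suc k) (Vec.map sum δ) → coeff (∏ (blocks k δ)) e ≡ 0ℚ
blocks-homogeneous k []      e deg≢ =
  cong ⟦_⟧ (dec-false (allExponents? (ℕ._≟ 0) e) (deg≢ ∘ degree-0))
blocks-homogeneous k (α ∷ δ) e deg≢ = trans (coeff-∏-++ k α (blocks (suc k) δ) e)
  (act-homogeneous k (blocks-homogeneous (suc k) δ) α e deg≢)

dyadicEntry : ℕ → List ℕ → ℚ
dyadicEntry k []      = 1ℚ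
dyadicEntry k (_ ∷ _) = ⟦ does (powerOf2? (suc k)) ⟧

-- The indicator of dyadicity as a product over the entries, which lets the sum over `δ` be split
-- one entry at a time.
dyadic : ℕ → ListSeq n → ℚ
dyadic k []      = 1ℚ
dyadic k (α ∷ δ) = dyadicEntry k α * dyadic (suc k) δ

-- The condition on a tail whose first entry has multiplicity `suc k`; at `k = 0` it unfolds to
-- `IsDyadic`.
DyadicFrom : ℕ → ListSeq n → Set
DyadicFrom {n} k δ = (i : Fin n) → lookup δ i ≢ [] → ∃ λ j → suc (k ℕ.+ toℕ i) ≡ 2 ^ j

module _ {k : ℕ} {α : List ℕ} {δ : ListSeq n} where
  DyadicFrom-∷⁺ : (α ≢ [] → ∃ λ j → suc k ≡ 2 ^ j) → DyadicFrom (suc k) δ → DyadicFrom k (α ∷ δ)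
  DyadicFrom-∷⁺ p ps zero    α≢ with p α≢
  ... | j , eq = j , trans (cong suc (ℕ.+-identityʳ k)) eq
  DyadicFrom-∷⁺ p ps (suc i) δ≢ with ps i δ≢
  ... | j , eq = j , trans (cong suc (ℕ.+-suc k (toℕ i))) eq

  DyadicFrom-head : DyadicFrom k (α ∷ δ) → α ≢ [] → ∃ λ j → suc k ≡ 2 ^ j
  DyadicFrom-head ps α≢ with ps zero α≢
  ... | j , eq = j , trans (sym (cong suc (ℕ.+-identityʳ k))) eq

  DyadicFrom-tail : DyadicFrom k (α ∷ δ) → DyadicFrom (suc k) δ
  DyadicFrom-tail ps i δ≢ with ps (suc i) δ≢
  ... | j , eq = j , trans (sym (cong suc (ℕ.+-suc k (toℕ i)))) eq

dyadic-1 : ∀ k (δ : ListSeq n) → DyadicFrom k δ → dyadic k δ ≡ 1ℚ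
dyadic-1 k []      ps = refl
dyadic-1 k (α ∷ δ) ps =
  trans (cong₂ _*_ (entry α ps) (dyadic-1 (suc k) δ (DyadicFrom-tail ps))) refl
  where
  entry : ∀ α → DyadicFrom k (α ∷ δ) → dyadicEntry k α ≡ 1ℚ
  entry []      ps = refl
  entry (_ ∷ _) ps = cong ⟦_⟧ (dec-true (powerOf2? (suc k)) (DyadicFrom-head ps λ ()))

dyadic-0 : ∀ k (δ : ListSeq n) → ¬ DyadicFrom k δ → dyadic k δ ≡ 0ℚ
dyadic-0 k []       ¬ps = contradiction (λ ()) ¬ps
dyadic-0 k ([] ∷ δ) ¬ps = trans (ℚ.*-identityˡ (dyadic (suc k) δ))
  (dyadic-0 (suc k) δ (λ ps → ¬ps (DyadicFrom-∷⁺ (contradiction refl) ps)))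
dyadic-0 k ((a ∷ α) ∷ δ) ¬ps = lemma (powerOf2? (suc k))
  where
  lemma : Dec (∃ λ j → suc k ≡ 2 ^ j) → dyadic k ((a ∷ α) ∷ δ) ≡ 0ℚ
  lemma (yes p) = trans (cong (⟦ does (powerOf2? (suc k)) ⟧ *_)
    (dyadic-0 (suc k) δ (λ ps → ¬ps (DyadicFrom-∷⁺ (λ _ → p) ps))))
    (ℚ.*-zeroʳ ⟦ does (powerOf2? (suc k)) ⟧)
  lemma (no ¬p) = trans (cong (λ b → ⟦ b ⟧ * dyadic (suc k) δ) (dec-false (powerOf2? (suc k)) ¬p))
    (ℚ.*-zeroˡ (dyadic (suc k) δ))

⟦isDyadic?⟧ : (δ : ListSeq n) → ⟦ does (isDyadic? δ) ⟧ ≡ dyadic 0 δ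
⟦isDyadic?⟧ δ = lemma (isDyadic? δ)
  where
  lemma : (D? : Dec (IsDyadic δ)) → ⟦ does D? ⟧ ≡ dyadic 0 δ
  lemma (yes p) = sym (dyadic-1 0 δ p)
  lemma (no ¬p) = sym (dyadic-0 0 δ ¬p)

sign-+ : ∀ m n → sign (m ℕ.+ n) ≡ sign m * sign n
sign-+ zero    n = sym (ℚ.*-identityˡ (sign n))
sign-+ (suc m) n = trans (cong -_ (sign-+ m n)) (ℚ.neg-distribˡ-* (sign m) (sign n))

-- Telescoping over the multiplicities

mult-χ⁻-small : ∀ r (e : Exponents m n) → degree e < r → mult (χ⁻ r) e ≡ mult ⟦ 0 ≟_⟧ e
mult-χ⁻-small r e deg<r = mult-cong-All (VecAll.map (VecAll.map λ {k} k≤deg →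
  trans (cong (λ x → ⟦ 0 ≟ k ⟧ + - x) (⟦≟⟧-≢ r k λ { refl → ℕ.<⇒≱ deg<r k≤deg }))
        (ℚ.+-identityʳ ⟦ 0 ≟ k ⟧)) (degree-entries e))

-- Nonempty entries have weight 0 at this multiplicity, so `α = []` alone survives.
∑-dyadicEntry-no : ∀ {D} k {f : Monomial N → ℚ} → ¬ (∃ λ j → suc k ≡ 2 ^ j) → ∀ e →
  ∑[ α ∈ compositions≤ D ] (dyadicEntry k α * (sign (length α) * act k f α e)) ≡ f e
∑-dyadicEntry-no {D = D} k {f} ¬pow e = begin
  ∑[ α ∈ compositions≤ D ] (dyadicEntry k α * (sign (length α) * act k f α e))
    ≡⟨ ∑-compositions≤ D _ ⟩
  1ℚ * (1ℚ * f e) + ∑[ i ∈ upTo D ] ∑[ α ∈ compositions≤ (D ∸ suc i) ]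
      (⟦ does (powerOf2? (suc k)) ⟧ * (sign (suc (length α)) * act k f (suc i ∷ α) e))
    ≡⟨ cong₂ _+_ (trans (ℚ.*-identityˡ (1ℚ * f e)) (ℚ.*-identityˡ (f e)))
         (trans (∑-cong (upTo D) (λ i → trans
           (∑-cong (compositions≤ (D ∸ suc i)) (λ α →
             zero* (sign (suc (length α)) * act k f (suc i ∷ α) e)))
           (∑-0 (compositions≤ (D ∸ suc i))))) (∑-0 (upTo D))) ⟩
  f e + 0ℚ
    ≡⟨ ℚ.+-identityʳ (f e) ⟩
  f e ∎
  where
  zero* : ∀ x → ⟦ does (powerOf2? (suc k)) ⟧ * x ≡ 0ℚ
  zero* x = trans (cong (λ b → ⟦ b ⟧ * x) (dec-false (powerOf2? (suc k)) ¬pow)) (ℚ.*-zeroˡ x)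

∑-dyadicEntry-yes : ∀ {D} k {f g : Monomial N → ℚ} → (∃ λ j → suc k ≡ 2 ^ j) →
  (∀ e → (mult (χ⁺ (suc k)) ✶ g) e ≡ f e) → ∀ e → degree e ≤ D →
  ∑[ α ∈ compositions≤ D ] (dyadicEntry k α * (sign (length α) * act k f α e)) ≡ g e
∑-dyadicEntry-yes {D = D} k {f} pow eq e le = trans
  (∑-cong (compositions≤ D) (λ α → trans
    (cong (_* (sign (length α) * act k f α e)) (one α))
    (ℚ.*-identityˡ (sign (length α) * act k f α e))))
  (∑-act k eq D e le)
  where
  one : ∀ α → dyadicEntry k α ≡ 1ℚ
  one []      = refl
  one (_ ∷ _) = cong ⟦_⟧ (dec-true (powerOf2? (suc k)) pow)

-- The telescoping: the part of multiplicity suc k turns χ⁻ (2 ^ suc j) into χ⁻ (2 ^ j) if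
-- suc k = 2 ^ j, and changes nothing otherwise.  For n = 0 and D ≤ k < 2 ^ j, the product of the
-- 1 - y ^ 2 ^ j is 1 in degrees ≤ D.
∑-blocks : ∀ {D} n k j → D ≤ k ℕ.+ n → k < 2 ^ j → (∀ i → k < 2 ^ i → j ≤ i) →
  (e : Monomial N) → degree e ≤ D →
  ∑[ δ ∈ vecsOver (compositions≤ D) n ] (dyadic k δ * (sign (ℓ δ) * coeff (∏ (blocks k δ)) e))
  ≡ mult (χ⁻ (2 ^ j)) e
∑-blocks zero k j D≤ k<2^j least e le = begin
  ∑[ δ ∈ [] ∷ [] ] (dyadic k δ * (sign (ℓ δ) * coeff (∏ (blocks k δ)) e))
    ≡⟨ trans (∑-∷ [] [] _) (trans (cong (1ℚ * (1ℚ * coeff 𝟙 e) +_) (∑-[] _)) (ℚ.+-identityʳ _)) ⟩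
  1ℚ * (1ℚ * coeff 𝟙 e)
    ≡⟨ trans (ℚ.*-identityˡ (1ℚ * coeff 𝟙 e)) (ℚ.*-identityˡ (coeff 𝟙 e)) ⟩
  coeff 𝟙 e
    ≡⟨ coeff-𝟙 e ⟩
  mult ⟦ 0 ≟_⟧ e
    ≡⟨ mult-χ⁻-small (2 ^ j) e (ℕ.≤-<-trans
         (ℕ.≤-trans le (ℕ.≤-trans D≤ (ℕ.≤-reflexive (ℕ.+-identityʳ k)))) k<2^j) ⟨
  mult (χ⁻ (2 ^ j)) e ∎
∑-blocks {N} {D} (suc n) k j D≤ k<2^j least e le = begin
  ∑[ δ ∈ vecsOver (compositions≤ D) (suc n) ] (dyadic k δ * (sign (ℓ δ) * coeff (∏ (blocks k δ)) e))
    ≡⟨ ∑-cartesianProductWith _∷_ (compositions≤ D) (vecsOver (compositions≤ D) n) _ ⟩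
  ∑[ α ∈ compositions≤ D ] ∑[ δ ∈ vecsOver (compositions≤ D) n ]
    (dyadic k (α ∷ δ) * (sign (ℓ (α ∷ δ)) * coeff (∏ (blocks k (α ∷ δ))) e))
    ≡⟨ ∑-cong (compositions≤ D) factor ⟩
  ∑[ α ∈ compositions≤ D ] (dyadicEntry k α * (sign (length α) * act k tails α e))
    ≡⟨ step (powerOf2? (suc k)) ⟩
  mult (χ⁻ (2 ^ j)) e ∎
  where
  tails : Monomial N → ℚ
  tails b = ∑[ δ ∈ vecsOver (compositions≤ D) n ]
    ((dyadic (suc k) δ * sign (ℓ δ)) * coeff (∏ (blocks (suc k) δ)) b)

  regroup : ∀ x y z u v → (x * y) * ((z * u) * v) ≡ (x * z) * ((y * u) * v)
  regroup = solve 5 (λ x y z u v → (x :* y) :* ((z :* u) :* v) := (x :* z) :* ((y :* u) :* v)) refl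
    where open +-*-Solver

  factor : ∀ α → ∑[ δ ∈ vecsOver (compositions≤ D) n ]
      (dyadic k (α ∷ δ) * (sign (ℓ (α ∷ δ)) * coeff (∏ (blocks k (α ∷ δ))) e))
    ≡ dyadicEntry k α * (sign (length α) * act k tails α e)
  factor α = begin
    ∑[ δ ∈ vecsOver (compositions≤ D) n ]
      (dyadic k (α ∷ δ) * (sign (ℓ (α ∷ δ)) * coeff (∏ (blocks k (α ∷ δ))) e))
      ≡⟨ ∑-cong (vecsOver (compositions≤ D) n) (λ δ → trans
           (cong₂ (λ s c → (dyadicEntry k α * dyadic (suc k) δ) * (s * c))
             (sign-+ (length α) (ℓ δ)) (coeff-∏-++ k α (blocks (suc k) δ) e))
           (regroup (dyadicEntry k α) (dyadic (suc k) δ) (sign (length α)) (sign (ℓ δ)) _)) ⟩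
    ∑[ δ ∈ vecsOver (compositions≤ D) n ] ((dyadicEntry k α * sign (length α)) *
      ((dyadic (suc k) δ * sign (ℓ δ)) * act k (coeff (∏ (blocks (suc k) δ))) α e))
      ≡⟨ ∑-*ˡ (dyadicEntry k α * sign (length α)) (vecsOver (compositions≤ D) n) _ ⟩
    (dyadicEntry k α * sign (length α)) * ∑[ δ ∈ vecsOver (compositions≤ D) n ]
      ((dyadic (suc k) δ * sign (ℓ δ)) * act k (coeff (∏ (blocks (suc k) δ))) α e)
      -- Linearity moves the sum over the later entries inside the product, where the induction
      -- hypothesis can replace it by a closed form.
      ≡⟨ cong ((dyadicEntry k α * sign (length α)) *_)
           (act-∑ k (vecsOver (compositions≤ D) n) (λ δ → dyadic (suc k) δ * sign (ℓ δ))
             (λ δ → coeff (∏ (blocks (suc k) δ))) α e) ⟨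
    (dyadicEntry k α * sign (length α)) * act k tails α e
      ≡⟨ ℚ.*-assoc (dyadicEntry k α) (sign (length α)) _ ⟩
    dyadicEntry k α * (sign (length α) * act k tails α e) ∎

  tails≡ : ∀ j → suc k < 2 ^ j → (∀ i → suc k < 2 ^ i → j ≤ i) → ∀ e → degree e ≤ D →
    tails e ≡ mult (χ⁻ (2 ^ j)) e
  tails≡ j lt least e le = trans
    (∑-cong (vecsOver (compositions≤ D) n) (λ δ → ℚ.*-assoc (dyadic (suc k) δ) _ _))
    (∑-blocks n (suc k) j (ℕ.≤-trans D≤ (ℕ.≤-reflexive (ℕ.+-suc k n))) lt least e le)

  replaceTails : ∀ {g} → (∀ e → degree e ≤ D → tails e ≡ g e) →
    ∑[ α ∈ compositions≤ D ] (dyadicEntry k α * (sign (length α) * act k tails α e))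
    ≡ ∑[ α ∈ compositions≤ D ] (dyadicEntry k α * (sign (length α) * act k g α e))
  replaceTails eq = ∑-cong (compositions≤ D) (λ α →
    cong (λ x → dyadicEntry k α * (sign (length α) * x)) (act-cong k eq α e le))

  step : Dec (∃ λ i → suc k ≡ 2 ^ i) →
    ∑[ α ∈ compositions≤ D ] (dyadicEntry k α * (sign (length α) * act k tails α e))
    ≡ mult (χ⁻ (2 ^ j)) e
  step (no ¬pow) = trans
    -- As `suc k` is not a power of 2, `2 ^ j` is also the least power exceeding `suc k`.
    (replaceTails (tails≡ j (ℕ.≤∧≢⇒< k<2^j (λ eq → ¬pow (j , eq)))
                          (λ i lt → least i (ℕ.<-trans (ℕ.n<1+n k) lt))))
    (∑-dyadicEntry-no {D = D} k ¬pow e)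
  step (yes (i , 1+k≡2^i)) = trans
    -- A power of 2 just above `k` must be `2 ^ j` by minimality, and the next one is `2 ^ suc j`.
    (replaceTails (tails≡ (suc j)
      (ℕ.<-≤-trans (ℕ.≤-<-trans k<2^j (ℕ.m<m+n (2 ^ j) (ℕ.≤-<-trans z≤n k<2^j)))
        (ℕ.≤-reflexive double))
      (λ i′ lt → ℕ.≰⇒> (λ i′≤j → ℕ.<⇒≱ lt (ℕ.≤-trans (ℕ.^-monoʳ-≤ 2 i′≤j)
        (ℕ.≤-reflexive (sym 1+k≡2^j)))))))
    -- Here `f` is ∏ (1 - y^(2^(j+1))) and `g` is ∏ (1 - y^(2^j)); their quotient is ∏ (1 +
    -- y^(2^j)).
    (trans (∑-dyadicEntry-yes {D = D} k (j , 1+k≡2^j)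
        (λ b → trans (χ⁺✶χ⁻ (suc k) b)
          (cong (λ r → mult (χ⁻ r) b) (trans (cong₂ ℕ._+_ 1+k≡2^j 1+k≡2^j) double))) e le)
      (cong (λ r → mult (χ⁻ r) e) 1+k≡2^j))
    where
    double : 2 ^ j ℕ.+ 2 ^ j ≡ 2 ^ suc j
    double = cong (2 ^ j ℕ.+_) (sym (ℕ.+-identityʳ (2 ^ j)))
    1+k≡2^j : suc k ≡ 2 ^ j
    1+k≡2^j = ℕ.≤-antisym k<2^j (ℕ.≤-trans
      (ℕ.^-monoʳ-≤ 2 (least i (ℕ.≤-reflexive 1+k≡2^i))) (ℕ.≤-reflexive (sym 1+k≡2^i)))

-- Coefficients of E_d and the conclusion

coeff-⨁ : (xs : List A) (f : A → Series) (e : Monomial N) →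
  coeff (⨁ (map f xs)) e ≡ ∑[ x ∈ xs ] coeff (f x) e
coeff-⨁ []       f e = sym (∑-[] _)
coeff-⨁ (x ∷ xs) f e = trans (cong (coeff (f x) e +_) (coeff-⨁ xs f e)) (sym (∑-∷ x xs _))

if-sign : ∀ b c m n → (if b ∧ c then sign (m ℕ.+ n) else 0ℚ)
  ≡ (if b then sign m else 0ℚ) * (if c then sign n else 0ℚ)
if-sign true  true  m n = sign-+ m n
if-sign true  false m n = sym (ℚ.*-zeroʳ (sign m))
if-sign false c     m n = sym (ℚ.*-zeroˡ (if c then sign n else 0ℚ))

-- In the product of the 1 - y an exponent 0 contributes 1, an exponent 1 contributes -1 and a
-- larger one 0, so the sign counts the indeterminates present.
sign-row : (v : Vec ℕ n) →
  (if does (VecAll.all? (ℕ._≤? 1) v) then sign (Vec.count (1 ℕ.≤?_) v) else 0ℚ) ≡ prod (χ⁻ 1) v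
sign-row []                = refl
sign-row (0 ∷ v)           = trans (sign-row v) (sym (ℚ.*-identityˡ (prod (χ⁻ 1) v)))
sign-row (1 ∷ v)           = trans
  (if-sign true (does (VecAll.all? (ℕ._≤? 1) v)) 1 (Vec.count (1 ℕ.≤?_) v))
  (cong (- 1ℚ *_) (sign-row v))
sign-row (suc (suc x) ∷ v) = sym (ℚ.*-zeroˡ (prod (χ⁻ 1) v))

sign-numIndeterminates : (e : Exponents m n) →
  (if does (allExponents? (ℕ._≤? 1) e) then sign (numIndeterminates e) else 0ℚ) ≡ mult (χ⁻ 1) e
sign-numIndeterminates []      = refl
sign-numIndeterminates (v ∷ e) = trans
  (if-sign (does (VecAll.all? (ℕ._≤? 1) v)) _ (Vec.count (1 ℕ.≤?_) v) (numIndeterminates e))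
  (cong₂ _*_ (sign-row v) (sign-numIndeterminates e))

coeff-E : (e : Monomial N) → coeff (E (degree e)) e ≡ mult (χ⁻ 1) e
coeff-E e = trans (cong (λ b → if b then sign (numIndeterminates e) else 0ℚ)
    (does-⇔ (mk⇔ proj₁ (_, refl)) (squareFreeOfDegree? (degree e) e) (allExponents? (ℕ._≤? 1) e)))
  (sign-numIndeterminates e)

∈-compositions≤ : ∀ D {α} → α ∈ compositions≤ D → IsComposition α
∈-compositions≤ D α∈ with find (∈-concatMap⁻ compositions {xs = upTo (suc D)} α∈)
... | n , _ , α∈n = ∈-compositions⇒nonZero n α∈n

∈-vecsOver⁻ : {P : A → Set} {xs : List A} → (∀ {x} → x ∈ xs → P x) →
  ∀ n {v} → v ∈ vecsOver xs n → VecAll.All P v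
∈-vecsOver⁻           p zero    (here refl) = []
∈-vecsOver⁻ {xs = xs} p (suc n) v∈ with ∈-cartesianProductWith⁻ _∷_ xs (vecsOver xs n) v∈
... | _ , _ , x∈ , v∈′ , refl = p x∈ ∷ ∈-vecsOver⁻ p n v∈′

E⁺-poly-homogeneous : (δ : ListSeq n) (e : Monomial N) →
  degree e ≢ weighted 1 (Vec.map sum δ) → coeff (sign (ℓ δ) · E⁺-poly δ) e ≡ 0ℚ
E⁺-poly-homogeneous δ e deg≢ = trans
  (cong (sign (ℓ δ) *_) (trans (cong (λ f → coeff f e) (E⁺-poly-blocks δ))
                               (blocks-homogeneous 0 δ e deg≢)))
  (ℚ.*-zeroʳ (sign (ℓ δ)))

proposition30 : (d : ℕ) → E d ≈ ⨁ (map (λ δ → sign (ℓ δ) · E⁺-poly δ) (PComDyad d))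
proposition30 d {N} e = trans (main (degree e ℕ.≟ d)) (sym (coeff-⨁ (PComDyad d) _ e))
  where
  term : ListSeq n → ℚ
  term δ = coeff (sign (ℓ δ) · E⁺-poly δ) e

  P? : Decidable (λ (δ : ListSeq n) → IsPolycomposition δ × IsDyadic δ)
  P? δ = isPolycomposition? δ ×-dec isDyadic? δ

  -- The constraint on the weight may be dropped: terms of the wrong weight do not involve e.
  unfilter : ∀ {δ} → δ ∈ vecsOver (compositions≤ (degree e)) (degree e) →
    ⟦ does (P? δ) ⟧ * term δ ≡ dyadic 0 δ * (sign (ℓ δ) * coeff (∏ (blocks 0 δ)) e)
  unfilter {δ} δ∈ = trans (lemma (weighted 1 (Vec.map sum δ) ℕ.≟ degree e))
    (cong (λ f → dyadic 0 δ * (sign (ℓ δ) * coeff f e)) (E⁺-poly-blocks δ))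
    where
    lemma : Dec (weighted 1 (Vec.map sum δ) ≡ degree e) →
      ⟦ does (P? δ) ⟧ * term δ ≡ dyadic 0 δ * term δ
    lemma (yes w) = cong (_* term δ) (trans
      (cong (λ b → ⟦ b ∧ does (isDyadic? δ) ⟧) (dec-true (isPolycomposition? δ)
        (∈-vecsOver⁻ (∈-compositions≤ (degree e)) (degree e) δ∈ , w)))
      (⟦isDyadic?⟧ δ))
    lemma (no ¬w) = trans (zero* ⟦ does (P? δ) ⟧) (sym (zero* (dyadic 0 δ)))
      where
      zero* : ∀ x → x * term δ ≡ 0ℚ
      zero* x = trans (cong (x *_) (E⁺-poly-homogeneous δ e (¬w ∘ sym))) (ℚ.*-zeroʳ x)

  main : Dec (degree e ≡ d) → coeff (E d) e ≡ ∑[ δ ∈ PComDyad d ] term δ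
  main (yes refl) = begin
    coeff (E (degree e)) e
      ≡⟨ coeff-E e ⟩
    mult (χ⁻ 1) e
      -- All multiplicities from 1 to `degree e` are present, and `2 ^ 0` is the least power of 2
      -- exceeding 0.
      ≡⟨ ∑-blocks (degree e) 0 0 ℕ.≤-refl (s≤s z≤n) (λ _ _ → z≤n) e ℕ.≤-refl ⟨
    ∑[ δ ∈ vecsOver (compositions≤ (degree e)) (degree e) ]
      (dyadic 0 δ * (sign (ℓ δ) * coeff (∏ (blocks 0 δ)) e))
      ≡⟨ ∑-cong-∈ (vecsOver (compositions≤ (degree e)) (degree e)) unfilter ⟨
    ∑[ δ ∈ vecsOver (compositions≤ (degree e)) (degree e) ] (⟦ does (P? δ) ⟧ * term δ)
      ≡⟨ ∑-filter P? (vecsOver (compositions≤ (degree e)) (degree e)) term ⟨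
    ∑[ δ ∈ PComDyad (degree e) ] term δ ∎
  main (no deg≢) = begin
    coeff (E d) e
      ≡⟨ cong (λ b → if b then sign (numIndeterminates e) else 0ℚ)
           (dec-false (squareFreeOfDegree? d e) (deg≢ ∘ proj₂)) ⟩
    0ℚ
      ≡⟨ ∑-0 (PComDyad d) ⟨
    ∑[ δ ∈ PComDyad d ] 0ℚ
      -- Every `δ` in `PComDyad d` has weight `d`, so homogeneity makes its term vanish at `e`.
      ≡⟨ ∑-cong-∈ (PComDyad d) (λ {δ} δ∈ → E⁺-poly-homogeneous δ e (λ eq →
           deg≢ (trans eq (proj₂ (proj₁ (Equivalence.to (∈-PComDyad δ) δ∈)))))) ⟨
    ∑[ δ ∈ PComDyad d ] term δ ∎
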